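{- There exist absolute positive constants $c_1, c_2, c_3$ such that the following holds. Let $k \geq 1$ and $q \geq 2$ be integers, and let $F$ be a $k$-uniform hypergraph with $t$ vertices and $\ell \geq 1$ edges. Then \[ r_{\mathrm{ind}}(F; q) \leq 2^{c_1 k \ell^3\log(q t \ell)}R^{c_2 k \ell^2 + c_3t\ell}, \] where $R = r(F; q)$ is the classical $q$-color Ramsey number of $F$.
   Context: For a $k$-uniform hypergraph $F$ and an integer $q \geq 2$, the Ramsey number $r(F;q)$ is the smallest natural number $n$ such that every $q$-coloring of the edges of the complete $k$-uniform hypergraph $K_n^{(k)}$ on $n$ vertices contains a monochromatic copy of $F$. A $k$-uniform hypergraph $F$ is an induced subgraph of a $k$-uniform hypergraph $G$ if $V(F)\subset V(G)$ and any $k$ vertices of $F$ form an edge of $F$ if and only if they form an edge of $G$. The induced Ramsey number $r_{\mathrm{ind}}(F;q)$ is the smallest natural number $n$ for which there exists a $k$-uniform hypergraph $G$ on $n$ vertices such that every $q$-coloring of the edges of $G$ contains an induced monochromatic copy of $F$ (i.e., a copy of $F$ that is an induced subgraph of $G$ and all of whose edges have the same color). -}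

module Defs where

open import Data.Nat using (ℕ; zero; suc; _<_)
open import Data.Bool using (Bool; true; false; _∧_; _∨_)
open import Data.Fin using (Fin; _≟_)
import Data.Fin as Fin
open import Data.Fin.Subset using (Subset; ∣_∣)
open import Data.Vec using (tabulate; lookup)
open import Data.List using (List; length)
open import Data.List.Membership.Propositional using (_∈_)
open import Data.List.Relation.Unary.All using (All)
open import Data.List.Relation.Unary.Unique.Propositional using (Unique)
open import Data.Product using (Σ; ∃; _×_)
open import Function.Definitions using (Injective)
open import Relation.Binary.PropositionalEquality using (_≡_)
open import Relation.Nullary using (¬_)
open import Relation.Nullary.Decidable using (⌊_⌋)

record Hypergraph (k n : ℕ) : Set where
  field
    edges   : List (Subset n)
    unique  : Unique edges
    uniform : All (λ e → ∣ e ∣ ≡ k) edges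
open Hypergraph public

numEdges : ∀ {k n} → Hypergraph k n → ℕ
numEdges H = length (edges H)

anyFin : ∀ {t} → (Fin t → Bool) → Bool
anyFin {zero}  f = false
anyFin {suc t} f = f Fin.zero ∨ anyFin (λ i → f (Fin.suc i))

image : ∀ {t n} → (Fin t → Fin n) → Subset t → Subset n
image φ S = tabulate (λ j → anyFin (λ i → lookup S i ∧ ⌊ φ i ≟ j ⌋))

-- A q-colouring of the k-sets of Fin n (only the values on edges matter).
Colouring : ℕ → ℕ → Set
Colouring n q = Subset n → Fin q

IsCopy : ∀ {k t n} → Hypergraph k t → Hypergraph k n → (Fin t → Fin n) → Set
IsCopy F G φ = Injective _≡_ _≡_ φ × All (λ e → image φ e ∈ edges G) (edges F)

IsInducedCopy : ∀ {k t n} → Hypergraph k t → Hypergraph k n → (Fin t → Fin n) → Set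
IsInducedCopy {k} {t} F G φ =
  IsCopy F G φ × (∀ (S : Subset t) → ∣ S ∣ ≡ k → image φ S ∈ edges G → S ∈ edges F)

Monochromatic : ∀ {k t n q} → Hypergraph k t → Colouring n q → (Fin t → Fin n) → Set
Monochromatic {q = q} F χ φ = Σ (Fin q) λ c → All (λ e → χ (image φ e) ≡ c) (edges F)

CompleteArrows : ∀ {k t} → ℕ → Hypergraph k t → ℕ → Set
CompleteArrows {k} {t} n F q =
  (χ : Colouring n q) → Σ (Fin t → Fin n) λ φ →
    Injective _≡_ _≡_ φ × Monochromatic F χ φ

IsRamseyNumber : ∀ {k t} → Hypergraph k t → ℕ → ℕ → Set
IsRamseyNumber F q R = CompleteArrows R F q × (∀ m → m < R → ¬ CompleteArrows m F q)

InducedArrows : ∀ {k t n} → Hypergraph k n → Hypergraph k t → ℕ → Set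
InducedArrows {t = t} {n = n} G F q =
  (χ : Colouring n q) → Σ (Fin t → Fin n) λ φ →
    IsInducedCopy F G φ × Monochromatic F χ φ

{-# OPTIONS --safe #-}
module Submission where

open import Defs
open import Data.Bool using (Bool; true; false; _∧_; _∨_; not) renaming (T to IsTrue)
open import Data.Bool.ListAction using (all)
import Data.Bool.Properties as Bool
open import Data.Empty using (⊥-elim)
open import Data.Fin using (Fin; zero; suc; combine)
import Data.Fin as Fin
open import Data.Fin.Properties using (combine-injectiveˡ)
import Data.Fin.Properties as Fin
open import Data.Fin.Subset using (Subset; ∣_∣; ⁅_⁆; ⊥; _∪_)
open import Data.Fin.Subset.Properties using (∣⊥∣≡0; ∣p∣≤n; ∣p∣≤∣p∪q∣)
open import Data.List using (List; []; _∷_; length; map; _++_; allFin; cartesianProductWith; [_])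
import Data.List as List
open import Data.List.Membership.Propositional using (_∈_; _∉_)
open import Data.List.Membership.Propositional.Properties using (∈-map⁺; ∈-map⁻; ∈-++⁺ˡ; ∈-++⁺ʳ; ∈-++⁻; ∈-cartesianProductWith⁺; ∈-allFin; ∈-lookup)
open import Data.List.Properties using (length-++; length-map; map-tabulate; length-tabulate)
open import Data.List.Relation.Binary.Sublist.Propositional using (_⊆_; []; _∷_; _∷ʳ_)
import Data.List.Relation.Binary.Sublist.Propositional as Sublist
open import Data.List.Relation.Binary.Sublist.Propositional.Properties using (All-resp-⊆)
open import Data.List.Relation.Unary.All using (All; []; _∷_)
import Data.List.Relation.Unary.All as All
import Data.List.Relation.Unary.All.Properties as All
open import Data.List.Relation.Unary.AllPairs using ([]; _∷_)
open import Data.List.Relation.Unary.Any using (here; there; index)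
import Data.List.Relation.Unary.Any.Properties as Any
open import Data.List.Relation.Unary.Unique.Propositional using (Unique)
import Data.List.Relation.Unary.Unique.Propositional.Properties as Unique
open import Data.Nat hiding (_≟_)
import Data.Nat as ℕ
open import Data.Nat.Induction using (Acc; acc; <-wellFounded)
open import Data.Nat.Logarithm using (⌈log₂_⌉)
open import Data.Nat.Logarithm.Core using (⌈log2⌉)
open import Data.Nat.Properties hiding (_≟_)
open import Data.Nat.Tactic.RingSolver using (solve-∀)
open import Data.Product using (Σ; ∃; _×_; _,_; proj₁; proj₂)
open import Data.Sum using (_⊎_; inj₁; inj₂)
open import Data.Unit using (⊤)
open import Data.Vec using (Vec; []; _∷_; lookup; tabulate)
import Data.Vec as Vec
open import Data.Vec.Properties using (≡-dec; lookup∘tabulate; tabulate-cong; ∷-injectiveʳ; lookup-++ˡ; lookup-++ʳ)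
open import Function using (_∘_; id; const)
open import Function.Definitions using (Injective)
open import Relation.Binary using (DecidableEquality)
open import Relation.Binary.PropositionalEquality using (_≡_; _≢_; refl; sym; trans; cong; cong₂; subst)
open import Relation.Nullary using (¬_; Dec; yes; no)
open import Relation.Nullary.Decidable using (⌊_⌋)

-- Place R · M vertices in an R × M grid. Each of the M ^ R transversals x of the grid spans a copy
-- of the complete hypergraph on R vertices. G is a random set of k-sets of density 1 / P.
--
-- Suppose that for every colour c a container C c of the k-sets of colour c is known. Colouring each
-- transversal by the containers, the Ramsey property yields in each x either a k-set outside all
-- containers, or a copy of F whose edges lie in one container. If the first alternative prevails,
-- G misses at least M ^ k / 2 given k-sets. Otherwise some colour c receives many x; as only one
-- copy per x is used, a k-set w lies in at most M ^ (R - k) of these copies, and two k-sets lie in at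
-- most M ^ (R - k - 1). The edges of F are then fixed one after another to be edges of G of colour c,
-- choosing edges that lie in many of the remaining copies. If this gets stuck, the k-sets of large
-- degree contain no edge of colour c and are removed from C c, which shrinks it by a fixed proportion;
-- this can happen only boundedly often. If it succeeds, there are many monochromatic copies of F.
--
-- The whole exploration depends on few edges of G, so a union bound over its possible transcripts
-- shows that no set of M ^ k / 2 k-sets arising in it is missed by G. Moreover P is so large that G
-- contains fewer non-induced copies of F than the number of monochromatic copies found.

-- Indicators and finite sums of natural numbers

ι : Bool → ℕ
ι true  = 1
ι false = 0

ι≤1 : ∀ b → ι b ≤ 1
ι≤1 true  = ≤-refl
ι≤1 false = z≤n

ι-mono : ∀ {b c} → (b ≡ true → c ≡ true) → ι b ≤ ι c
ι-mono {false} h = z≤n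
ι-mono {true}  h rewrite h refl = ≤-refl

∧-introᵇ : ∀ {a b} → a ≡ true → b ≡ true → a ∧ b ≡ true
∧-introᵇ refl refl = refl

∧-elimˡ : ∀ {a b} → a ∧ b ≡ true → a ≡ true
∧-elimˡ {true} _ = refl

∧-elimʳ : ∀ {a b} → a ∧ b ≡ true → b ≡ true
∧-elimʳ {true} h = h

≤ᵇ-true : ∀ m n → (m ≤ᵇ n) ≡ true → m ≤ n
≤ᵇ-true m n h = ≤ᵇ⇒≤ m n (subst IsTrue (sym h) _)

≤ᵇ-false : ∀ m n → (m ≤ᵇ n) ≡ false → n < m
≤ᵇ-false m n h with m ≤? n
... | yes p = ⊥-elim (subst IsTrue h (≤⇒≤ᵇ p))
... | no ¬p = ≰⇒> ¬p

module _ {A : Set} where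

  ∑ : List A → (A → ℕ) → ℕ
  ∑ []      f = 0
  ∑ (a ∷ l) f = f a + ∑ l f

  ∑-mono-∈ : ∀ l {f g : A → ℕ} → (∀ a → a ∈ l → f a ≤ g a) → ∑ l f ≤ ∑ l g
  ∑-mono-∈ []      h = z≤n
  ∑-mono-∈ (a ∷ l) h = +-mono-≤ (h a (here refl)) (∑-mono-∈ l (λ b → h b ∘ there))

  ∑-mono : ∀ l {f g : A → ℕ} → (∀ a → f a ≤ g a) → ∑ l f ≤ ∑ l g
  ∑-mono l h = ∑-mono-∈ l (λ a _ → h a)

  ∑-cong : ∀ l {f g : A → ℕ} → (∀ a → f a ≡ g a) → ∑ l f ≡ ∑ l g
  ∑-cong []      h = refl
  ∑-cong (a ∷ l) h = cong₂ _+_ (h a) (∑-cong l h)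

  ∑-+ : ∀ l (f g : A → ℕ) → ∑ l (λ a → f a + g a) ≡ ∑ l f + ∑ l g
  ∑-+ []      f g = refl
  ∑-+ (a ∷ l) f g rewrite ∑-+ l f g = interchange (f a) (g a) (∑ l f) (∑ l g)
    where
    interchange : ∀ a b c d → (a + b) + (c + d) ≡ (a + c) + (b + d)
    interchange = solve-∀

  ∑-*ʳ : ∀ l (f : A → ℕ) c → ∑ l (λ a → f a * c) ≡ ∑ l f * c
  ∑-*ʳ []      f c = refl
  ∑-*ʳ (a ∷ l) f c rewrite ∑-*ʳ l f c = sym (*-distribʳ-+ c (f a) (∑ l f))

  ∑-*ˡ : ∀ l (f : A → ℕ) c → ∑ l (λ a → c * f a) ≡ c * ∑ l f
  ∑-*ˡ l f c = trans (∑-cong l (λ a → *-comm c (f a))) (trans (∑-*ʳ l f c) (*-comm (∑ l f) c))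

  ∑-const : ∀ l c → ∑ l (λ (_ : A) → c) ≡ length l * c
  ∑-const []      c = refl
  ∑-const (a ∷ l) c = cong (c +_) (∑-const l c)

  ∑-++ : ∀ l m (f : A → ℕ) → ∑ (l ++ m) f ≡ ∑ l f + ∑ m f
  ∑-++ []      m f = refl
  ∑-++ (a ∷ l) m f rewrite ∑-++ l m f = sym (+-assoc (f a) (∑ l f) (∑ m f))

  ∑-∈ : ∀ {l a} (f : A → ℕ) → a ∈ l → f a ≤ ∑ l f
  ∑-∈ f (here refl) = m≤m+n _ _
  ∑-∈ f (there a∈l) = ≤-trans (∑-∈ f a∈l) (m≤n+m _ _)

  -- The averaging principle behind both the pigeonhole over colours and the choice of a transversal
  -- that carries an induced copy.
  ∑-find : ∀ l (f g : A → ℕ) → ∑ l f < ∑ l g → Σ A λ a → a ∈ l × f a < g a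
  ∑-find (a ∷ l) f g h with f a <? g a
  ... | yes p = a , here refl , p
  ... | no ¬p with ∑-find l f g (+-cancelˡ-< (g a) _ _ (≤-<-trans (+-monoˡ-≤ (∑ l f) (≮⇒≥ ¬p)) h))
  ...   | b , b∈l , q = b , there b∈l , q

  ∑-⊆ : ∀ {l m} (f : A → ℕ) → l ⊆ m → ∑ l f ≤ ∑ m f
  ∑-⊆ f []           = z≤n
  ∑-⊆ f (a ∷ʳ s)     = ≤-trans (∑-⊆ f s) (m≤n+m _ _)
  ∑-⊆ f (refl ∷ s)   = +-monoʳ-≤ _ (∑-⊆ f s)

∑-swap : ∀ {A B : Set} l m (f : A → B → ℕ) → ∑ l (λ a → ∑ m (f a)) ≡ ∑ m (λ b → ∑ l (λ a → f a b))
∑-swap []      m f = sym (trans (∑-const m 0) (*-zeroʳ (length m)))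
∑-swap (a ∷ l) m f rewrite ∑-swap l m f = sym (∑-+ m (f a) (λ b → ∑ l (λ a → f a b)))

∑-map : ∀ {A B : Set} (g : A → B) l f → ∑ (map g l) f ≡ ∑ l (f ∘ g)
∑-map g []      f = refl
∑-map g (a ∷ l) f = cong (f (g a) +_) (∑-map g l f)

-- Double counting along the fibres of a map

module Fibres {A : Set} (_≟_ : DecidableEquality A) where

  infix 4 _==_
  _==_ : A → A → Bool
  a == b = ⌊ a ≟ b ⌋

  ==-refl : ∀ a → (a == a) ≡ true
  ==-refl a with a ≟ a
  ... | yes _ = refl
  ... | no ¬p = ⊥-elim (¬p refl)

  ==⇒≡ : ∀ {a b} → (a == b) ≡ true → a ≡ b
  ==⇒≡ {a} {b} h with a ≟ b
  ... | yes p = p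

  ∑-==-∉ : ∀ {a} l → a ∉ l → ∑ l (λ b → ι (a == b)) ≡ 0
  ∑-==-∉ []      a∉l = refl
  ∑-==-∉ {a} (b ∷ l) a∉l with a ≟ b
  ... | yes p = ⊥-elim (a∉l (here p))
  ... | no _  = ∑-==-∉ l (a∉l ∘ there)

  ∑-==-≤1 : ∀ a {l} → Unique l → ∑ l (λ b → ι (a == b)) ≤ 1
  ∑-==-≤1 a []                  = z≤n
  ∑-==-≤1 a {b ∷ l} (b≢ ∷ u) with a ≟ b
  ... | yes refl = ≤-reflexive (cong suc (∑-==-∉ l (λ b∈l → All.lookup b≢ b∈l refl)))
  ... | no _     = ∑-==-≤1 a u

  ∑-==-∈ : ∀ {a l} → a ∈ l → 1 ≤ ∑ l (λ b → ι (a == b))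
  ∑-==-∈ {a} {l} a∈l = subst (λ b → ι b ≤ ∑ l (λ b → ι (a == b))) (==-refl a) (∑-∈ (λ b → ι (a == b)) a∈l)

  infix 4 _∈ᵇ_
  _∈ᵇ_ : A → List A → Bool
  a ∈ᵇ []      = false
  a ∈ᵇ (b ∷ l) = (b == a) ∨ (a ∈ᵇ l)

  ∈ᵇ⇒∈ : ∀ {a} l → (a ∈ᵇ l) ≡ true → a ∈ l
  ∈ᵇ⇒∈ {a} (b ∷ l) h with b ≟ a
  ... | yes p = here (sym p)
  ... | no _  = there (∈ᵇ⇒∈ l h)

  ∈⇒∈ᵇ : ∀ {a l} → a ∈ l → (a ∈ᵇ l) ≡ true
  ∈⇒∈ᵇ {a} (here refl) rewrite ==-refl a = refl
  ∈⇒∈ᵇ {a} {b ∷ l} (there h) rewrite ∈⇒∈ᵇ h with b == a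
  ... | true  = refl
  ... | false = refl

  ι-∈ᵇ-≤ : ∀ a l → ι (a ∈ᵇ l) ≤ ∑ l (λ b → ι (b == a))
  ι-∈ᵇ-≤ a []      = z≤n
  ι-∈ᵇ-≤ a (b ∷ l) with b == a
  ... | true  = s≤s z≤n
  ... | false = ι-∈ᵇ-≤ a l

  ι-∈ᵇ-≥ : ∀ a {l} → Unique l → ∑ l (λ b → ι (b == a)) ≤ ι (a ∈ᵇ l)
  ι-∈ᵇ-≥ a []                 = z≤n
  ι-∈ᵇ-≥ a {b ∷ l} (b≢ ∷ u) with b ≟ a
  ... | yes refl = ≤-reflexive (cong suc (trans (∑-cong l flip) (∑-==-∉ l (λ b∈l → All.lookup b≢ b∈l refl))))
    where
    flip : ∀ c → ι (c == a) ≡ ι (a == c)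
    flip c with c ≟ a | a ≟ c
    ... | yes p | yes q = refl
    ... | yes p | no ¬q = ⊥-elim (¬q (sym p))
    ... | no ¬p | yes q = ⊥-elim (¬p (sym q))
    ... | no ¬p | no ¬q = refl
  ... | no _     = ι-∈ᵇ-≥ a u

  count-∈ᵇ-≤ : ∀ {l} ds → Unique l → ∑ l (λ w → ι (w ∈ᵇ ds)) ≤ length ds
  count-∈ᵇ-≤ {l} ds u = begin
    ∑ l (λ w → ι (w ∈ᵇ ds))                 ≤⟨ ∑-mono l (λ w → ι-∈ᵇ-≤ w ds) ⟩
    ∑ l (λ w → ∑ ds (λ d → ι (d == w)))     ≡⟨ ∑-swap l ds _ ⟩
    ∑ ds (λ d → ∑ l (λ w → ι (d == w)))     ≤⟨ ∑-mono ds (λ d → ∑-==-≤1 d u) ⟩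
    ∑ ds (λ _ → 1)                          ≡⟨ ∑-const ds 1 ⟩
    length ds * 1                           ≡⟨ *-identityʳ _ ⟩
    length ds                               ∎
    where open ≤-Reasoning

  count-∈ᵇ-≥ : ∀ {l ds} → Unique ds → All (_∈ l) ds → length ds ≤ ∑ l (λ w → ι (w ∈ᵇ ds))
  count-∈ᵇ-≥ {l} {ds} u ds⊆l = begin
    length ds                               ≡⟨ *-identityʳ _ ⟨
    length ds * 1                           ≡⟨ ∑-const ds 1 ⟨
    ∑ ds (λ _ → 1)                          ≤⟨ ∑-mono-∈ ds (λ d d∈ → ∑-==-∈ (All.lookup ds⊆l d∈)) ⟩
    ∑ ds (λ d → ∑ l (λ w → ι (d == w)))     ≡⟨ ∑-swap ds l _ ⟩
    ∑ l (λ w → ∑ ds (λ d → ι (d == w)))     ≤⟨ ∑-mono l (λ w → ι-∈ᵇ-≥ w u) ⟩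
    ∑ l (λ w → ι (w ∈ᵇ ds))                 ∎
    where open ≤-Reasoning

  module _ {X : Set} (xs : List X) (slot : X → A) where

    deg : (X → Bool) → A → ℕ
    deg h w = ∑ xs (λ x → ι (h x ∧ (slot x == w)))

    -- Each `x` on the left is paid for at `w = slot x`, so `l` only has to cover all slots.
    fibre-≤ : ∀ l (h : X → Bool) (p : A → Bool) → (∀ x → slot x ∈ l) →
              ∑ xs (λ x → ι (h x ∧ p (slot x))) ≤ ∑ l (λ w → ι (p w) * deg h w)
    fibre-≤ l h p slot∈ = begin
      ∑ xs (λ x → ι (h x ∧ p (slot x)))
        ≤⟨ ∑-mono xs pointwise ⟩
      ∑ xs (λ x → ∑ l (λ w → ι (p w) * ι (h x ∧ (slot x == w))))
        ≡⟨ ∑-swap xs l _ ⟩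
      ∑ l (λ w → ∑ xs (λ x → ι (p w) * ι (h x ∧ (slot x == w))))
        ≡⟨ ∑-cong l (λ w → ∑-*ˡ xs _ (ι (p w))) ⟩
      ∑ l (λ w → ι (p w) * deg h w) ∎
      where
      open ≤-Reasoning
      pointwise : ∀ x → ι (h x ∧ p (slot x)) ≤ ∑ l (λ w → ι (p w) * ι (h x ∧ (slot x == w)))
      pointwise x = ≤-trans own (∑-∈ (λ w → ι (p w) * ι (h x ∧ (slot x == w))) (slot∈ x))
        where
        own : ι (h x ∧ p (slot x)) ≤ ι (p (slot x)) * ι (h x ∧ (slot x == slot x))
        own rewrite ==-refl (slot x) with h x | p (slot x)
        ... | true  | true  = ≤-refl
        ... | true  | false = z≤n
        ... | false | _     = z≤n

    -- As `l` has no repetitions, a given `x` is counted at most once, namely at `w = slot x`.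
    fibre-≥ : ∀ {l} (h : X → Bool) → Unique l → ∑ l (deg h) ≤ ∑ xs (ι ∘ h)
    fibre-≥ {l} h u = begin
      ∑ l (λ w → ∑ xs (λ x → ι (h x ∧ (slot x == w))))   ≡⟨ ∑-swap l xs _ ⟩
      ∑ xs (λ x → ∑ l (λ w → ι (h x ∧ (slot x == w))))   ≤⟨ ∑-mono xs pointwise ⟩
      ∑ xs (ι ∘ h)                                       ∎
      where
      open ≤-Reasoning
      pointwise : ∀ x → ∑ l (λ w → ι (h x ∧ (slot x == w))) ≤ ι (h x)
      pointwise x with h x
      ... | true  = ∑-==-≤1 (slot x) u
      ... | false = ≤-reflexive (trans (∑-const l 0) (*-zeroʳ (length l)))

-- Random sublists

-- 𝔼 l f is (1 + p) ^ length l times the expectation of f on the random sublist of l that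
-- keeps each entry independently with probability 1 / (1 + p).
module Random (p : ℕ) {A : Set} where

  𝔼 : List A → (List A → ℕ) → ℕ
  𝔼 []      f = f []
  𝔼 (a ∷ l) f = 𝔼 l (f ∘ (a ∷_)) + p * 𝔼 l f

  𝔼-mono : ∀ l {f g} → (∀ G → G ⊆ l → f G ≤ g G) → 𝔼 l f ≤ 𝔼 l g
  𝔼-mono []      h = h [] []
  𝔼-mono (a ∷ l) h = +-mono-≤ (𝔼-mono l (λ G s → h (a ∷ G) (refl ∷ s)))
                              (*-monoʳ-≤ p (𝔼-mono l (λ G s → h G (a ∷ʳ s))))

  𝔼-const : ∀ l c → 𝔼 l (λ _ → c) ≡ suc p ^ length l * c
  𝔼-const []      c = sym (+-identityʳ c)
  𝔼-const (a ∷ l) c rewrite 𝔼-const l c = sym (*-assoc (suc p) (suc p ^ length l) c)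

  𝔼-zero : ∀ l {f} → (∀ G → G ⊆ l → f G ≡ 0) → 𝔼 l f ≡ 0
  𝔼-zero l {f} h = n≤0⇒n≡0 (begin
    𝔼 l f                    ≤⟨ 𝔼-mono l (λ G s → ≤-reflexive (h G s)) ⟩
    𝔼 l (λ _ → 0)            ≡⟨ 𝔼-const l 0 ⟩
    suc p ^ length l * 0     ≡⟨ *-zeroʳ (suc p ^ length l) ⟩
    0                        ∎)
    where open ≤-Reasoning

  𝔼-+ : ∀ l f g → 𝔼 l (λ G → f G + g G) ≡ 𝔼 l f + 𝔼 l g
  𝔼-+ []      f g = refl
  𝔼-+ (a ∷ l) f g rewrite 𝔼-+ l (f ∘ (a ∷_)) (g ∘ (a ∷_)) | 𝔼-+ l f g =
    rearrange p (𝔼 l (f ∘ (a ∷_))) (𝔼 l (g ∘ (a ∷_))) (𝔼 l f) (𝔼 l g)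
    where
    rearrange : ∀ p a b c d → (a + b) + p * (c + d) ≡ (a + p * c) + (b + p * d)
    rearrange = solve-∀

  𝔼-*ʳ : ∀ l f c → 𝔼 l (λ G → f G * c) ≡ 𝔼 l f * c
  𝔼-*ʳ []      f c = refl
  𝔼-*ʳ (a ∷ l) f c rewrite 𝔼-*ʳ l (f ∘ (a ∷_)) c | 𝔼-*ʳ l f c =
    rearrange p (𝔼 l (f ∘ (a ∷_))) (𝔼 l f) c
    where
    rearrange : ∀ p a b c → a * c + p * (b * c) ≡ (a + p * b) * c
    rearrange = solve-∀

  𝔼-∑ : ∀ {B : Set} l (m : List B) (f : B → List A → ℕ) →
        𝔼 l (λ G → ∑ m (λ b → f b G)) ≡ ∑ m (λ b → 𝔼 l (f b))
  𝔼-∑ l []      f = 𝔼-zero l (λ _ _ → refl)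
  𝔼-∑ l (b ∷ m) f = trans (𝔼-+ l (f b) (λ G → ∑ m (λ b → f b G))) (cong (𝔼 l (f b) +_) (𝔼-∑ l m f))

  -- Method of conditional expectations: the two branches have weights 1 and `p`, adding up to
  -- `suc p`, so if keeping `a` does not stay below the threshold, dropping it does.
  𝔼-find : ∀ l f c → 𝔼 l f < suc p ^ length l * c → Σ (List A) λ G → G ⊆ l × f G < c
  𝔼-find []      f c h = [] , [] , subst (f [] <_) (+-identityʳ c) h
  𝔼-find (a ∷ l) f c h with 𝔼 l (f ∘ (a ∷_)) <? suc p ^ length l * c
  ... | yes q with 𝔼-find l (f ∘ (a ∷_)) c q
  ...   | G , s , r = a ∷ G , refl ∷ s , r
  𝔼-find (a ∷ l) f c h | no ¬q
      with 𝔼-find l f c (*-cancelˡ-< p _ _ (+-cancelˡ-< (suc p ^ length l * c) _ _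
             (≤-<-trans (+-monoˡ-≤ (p * 𝔼 l f) (≮⇒≥ ¬q)) (<-≤-trans h (≤-reflexive (*-assoc (suc p) (suc p ^ length l) c))))))
  ...   | G , s , r = G , a ∷ʳ s , r

  -- The probability of avoiding `U` is `(p / suc p) ^ u` by independence; both sides are multiplied
  -- out to stay within natural numbers.
  𝔼-avoid : ∀ l (U : A → Bool) →
            𝔼 l (λ G → ι (all (not ∘ U) G)) * suc p ^ ∑ l (ι ∘ U) ≡ p ^ ∑ l (ι ∘ U) * suc p ^ length l
  𝔼-avoid []      U = refl
  𝔼-avoid (a ∷ l) U with U a
  ... | true  = begin
    (𝔼 l (λ _ → 0) + p * e) * (suc p * P) ≡⟨ cong (λ z → (z + p * e) * (suc p * P)) (𝔼-zero l (λ _ _ → refl)) ⟩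
    p * e * (suc p * P)     ≡⟨ rearrange p e (suc p) P ⟩
    p * suc p * (e * P)     ≡⟨ cong (p * suc p *_) (𝔼-avoid l U) ⟩
    p * suc p * (p ^ u * Q) ≡⟨ rearrange p (suc p) (p ^ u) Q ⟩
    p * p ^ u * (suc p * Q) ∎
    where
    open Relation.Binary.PropositionalEquality.≡-Reasoning
    e = 𝔼 l (λ G → ι (all (not ∘ U) G))
    u = ∑ l (ι ∘ U)
    P = suc p ^ u
    Q = suc p ^ length l
    rearrange : ∀ a b c d → a * b * (c * d) ≡ a * c * (b * d)
    rearrange = solve-∀
  ... | false = begin
    suc p * e * P                 ≡⟨ *-assoc (suc p) e P ⟩
    suc p * (e * P)               ≡⟨ cong (suc p *_) (𝔼-avoid l U) ⟩
    suc p * (p ^ u * Q)           ≡⟨ rearrange (suc p) (p ^ u) Q ⟩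
    p ^ u * (suc p * Q)           ∎
    where
    open Relation.Binary.PropositionalEquality.≡-Reasoning
    e = 𝔼 l (λ G → ι (all (not ∘ U) G))
    u = ∑ l (ι ∘ U)
    P = suc p ^ u
    Q = suc p ^ length l
    rearrange : ∀ a b c → a * (b * c) ≡ b * (a * c)
    rearrange = solve-∀

  -- For a sublist `G`, the comparison of the two counts says that `G` keeps every entry of `l`
  -- satisfying `D`. By independence this has probability `(1 / suc p) ^ d`, where `d` counts these
  -- entries.
  𝔼-contain : ∀ l (D : A → Bool) →
              𝔼 l (λ G → ι (∑ l (ι ∘ D) ≤ᵇ ∑ G (ι ∘ D))) * suc p ^ ∑ l (ι ∘ D) ≤ suc p ^ length l
  𝔼-contain []      D = ≤-refl
  𝔼-contain (a ∷ l) D with D a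
  ... | true  = begin
    (e₁ + p * e₂) * (suc p * P) ≡⟨ cong₂ (λ y z → (y + p * z) * (suc p * P)) e₁≡ e₂≡0 ⟩
    (e + p * 0) * (suc p * P)   ≡⟨ rearrange e p (suc p) P ⟩
    suc p * (e * P)             ≤⟨ *-monoʳ-≤ (suc p) (𝔼-contain l D) ⟩
    suc p * suc p ^ length l    ∎
    where
    open ≤-Reasoning
    d = ∑ l (ι ∘ D)
    P = suc p ^ d
    e = 𝔼 l (λ G → ι (d ≤ᵇ ∑ G (ι ∘ D)))
    e₁ = 𝔼 l (λ G → ι (suc d ≤ᵇ suc (∑ G (ι ∘ D))))
    e₂ = 𝔼 l (λ G → ι (suc d ≤ᵇ ∑ G (ι ∘ D)))
    ≤ᵇ-suc : ∀ m n → (suc m ≤ᵇ suc n) ≡ (m ≤ᵇ n)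
    ≤ᵇ-suc zero    n = refl
    ≤ᵇ-suc (suc m) n = refl
    ≤ᵇ-none : ∀ {m n} → n < m → (m ≤ᵇ n) ≡ false
    ≤ᵇ-none {m} {n} n<m with m ≤ᵇ n in h
    ... | false = refl
    ... | true  = ⊥-elim (<⇒≱ n<m (≤ᵇ-true m n h))
    e₁≡ : e₁ ≡ e
    e₁≡ = ≤-antisym
      (𝔼-mono l (λ G _ → ≤-reflexive (cong ι (≤ᵇ-suc d (∑ G (ι ∘ D))))))
      (𝔼-mono l (λ G _ → ≤-reflexive (sym (cong ι (≤ᵇ-suc d (∑ G (ι ∘ D)))))))
    -- A sublist that drops an entry satisfying `D` can no longer reach the full count.
    e₂≡0 : e₂ ≡ 0
    e₂≡0 = 𝔼-zero l (λ G s → cong ι (≤ᵇ-none (s≤s (∑-⊆ (ι ∘ D) s))))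
    rearrange : ∀ e p P Q → (e + p * 0) * (P * Q) ≡ P * (e * Q)
    rearrange = solve-∀
  ... | false = begin
    suc p * e * P               ≡⟨ *-assoc (suc p) e P ⟩
    suc p * (e * P)             ≤⟨ *-monoʳ-≤ (suc p) (𝔼-contain l D) ⟩
    suc p * suc p ^ length l    ∎
    where
    open ≤-Reasoning
    P = suc p ^ ∑ l (ι ∘ D)
    e = 𝔼 l (λ G → ι (∑ l (ι ∘ D) ≤ᵇ ∑ G (ι ∘ D)))

^-distribʳ-* : ∀ o x y → (x * y) ^ o ≡ x ^ o * y ^ o
^-distribʳ-* zero    x y = refl
^-distribʳ-* (suc o) x y rewrite ^-distribʳ-* o x y = inter x y (x ^ o) (y ^ o)
  where
  inter : ∀ a b c d → a * b * (c * d) ≡ a * c * (b * d)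
  inter = solve-∀

-- Subsets of Fin n of fixed size

_≟ˢ_ : ∀ {n} → DecidableEquality (Subset n)
_≟ˢ_ = ≡-dec Bool._≟_

kSubsets : ∀ n → ℕ → List (Subset n)
kSubsets zero    zero    = [ [] ]
kSubsets zero    (suc k) = []
kSubsets (suc n) zero    = map (false ∷_) (kSubsets n zero)
kSubsets (suc n) (suc k) = map (true ∷_) (kSubsets n k) ++ map (false ∷_) (kSubsets n (suc k))

∈-kSubsets : ∀ {n k} (p : Subset n) → ∣ p ∣ ≡ k → p ∈ kSubsets n k
∈-kSubsets {k = zero}  []          h    = here refl
∈-kSubsets {k = zero}  (false ∷ p) h    = ∈-map⁺ _ (∈-kSubsets p h)
∈-kSubsets {k = suc k} (true ∷ p)  h    = ∈-++⁺ˡ (∈-map⁺ _ (∈-kSubsets p (suc-injective h)))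
∈-kSubsets {k = suc k} (false ∷ p) h    = ∈-++⁺ʳ _ (∈-map⁺ _ (∈-kSubsets p h))

kSubsets-size : ∀ n k {p : Subset n} → p ∈ kSubsets n k → ∣ p ∣ ≡ k
kSubsets-size zero    zero    (here refl) = refl
kSubsets-size (suc n) zero    h with ∈-map⁻ _ h
... | p , p∈ , refl = kSubsets-size n zero p∈
kSubsets-size (suc n) (suc k) h with ∈-++⁻ (map (true ∷_) (kSubsets n k)) h
... | inj₁ h′ with ∈-map⁻ _ h′
...   | p , p∈ , refl = cong suc (kSubsets-size n k p∈)
kSubsets-size (suc n) (suc k) h | inj₂ h′ with ∈-map⁻ _ h′
...   | p , p∈ , refl = kSubsets-size n (suc k) p∈

kSubsets-unique : ∀ n k → Unique (kSubsets n k)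
kSubsets-unique zero    zero    = [] ∷ []
kSubsets-unique zero    (suc k) = []
kSubsets-unique (suc n) zero    = Unique.map⁺ ∷-injectiveʳ (kSubsets-unique n zero)
kSubsets-unique (suc n) (suc k) =
  Unique.++⁺ (Unique.map⁺ ∷-injectiveʳ (kSubsets-unique n k))
             (Unique.map⁺ ∷-injectiveʳ (kSubsets-unique n (suc k))) disjoint
  where
  disjoint : ∀ {p} → ¬ (p ∈ map (true ∷_) (kSubsets n k) × p ∈ map (false ∷_) (kSubsets n (suc k)))
  disjoint (h , h′) with ∈-map⁻ _ h | ∈-map⁻ _ h′
  ... | _ , _ , refl | _ , _ , ()

length-kSubsets : ∀ n k → length (kSubsets n k) ≤ n ^ k
length-kSubsets zero    zero    = ≤-refl
length-kSubsets zero    (suc k) = z≤n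
length-kSubsets (suc n) zero    =
  ≤-trans (≤-reflexive (length-map (false ∷_) (kSubsets n zero))) (length-kSubsets n zero)
length-kSubsets (suc n) (suc k) = begin
  length (map (true ∷_) (kSubsets n k) ++ map (false ∷_) (kSubsets n (suc k)))
    ≡⟨ length-++ (map (true ∷_) (kSubsets n k)) ⟩
  length (map (true ∷_) (kSubsets n k)) + length (map (false ∷_) (kSubsets n (suc k)))
    ≡⟨ cong₂ _+_ (length-map (true ∷_) (kSubsets n k)) (length-map (false ∷_) (kSubsets n (suc k))) ⟩
  length (kSubsets n k) + length (kSubsets n (suc k))
    ≤⟨ +-mono-≤ (length-kSubsets n k) (length-kSubsets n (suc k)) ⟩
  suc n * n ^ k
    ≤⟨ *-monoʳ-≤ (suc n) (^-monoˡ-≤ k (n≤1+n n)) ⟩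
  suc n * suc n ^ k ∎
  where open ≤-Reasoning

-- Images of subsets

anyFin-intro : ∀ {t} (f : Fin t → Bool) i → f i ≡ true → anyFin f ≡ true
anyFin-intro f Fin.zero    h rewrite h = refl
anyFin-intro f (Fin.suc i) h rewrite anyFin-intro (f ∘ Fin.suc) i h = Bool.∨-zeroʳ (f Fin.zero)

anyFin-elim : ∀ {t} (f : Fin t → Bool) → anyFin f ≡ true → ∃ λ i → f i ≡ true
anyFin-elim {suc t} f h with f zero in eq
... | true  = zero , eq
... | false with anyFin-elim (f ∘ suc) h
...   | i , q = suc i , q

⌊≟⌋-refl : ∀ {n} (i : Fin n) → ⌊ i Fin.≟ i ⌋ ≡ true
⌊≟⌋-refl i with i Fin.≟ i
... | yes _ = refl
... | no ¬p = ⊥-elim (¬p refl)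

image-intro : ∀ {t n} (φ : Fin t → Fin n) S i → lookup S i ≡ true → lookup (image φ S) (φ i) ≡ true
image-intro φ S i h = trans (lookup∘tabulate _ (φ i))
  (anyFin-intro _ i (∧-introᵇ h (⌊≟⌋-refl (φ i))))

image-elim : ∀ {t n} (φ : Fin t → Fin n) S j → lookup (image φ S) j ≡ true →
             ∃ λ i → lookup S i ≡ true × φ i ≡ j
image-elim φ S j h with anyFin-elim _ (trans (sym (lookup∘tabulate _ j)) h)
... | i , q with φ i Fin.≟ j
...   | yes p = i , ∧-elimˡ q , p
...   | no ¬p with lookup S i
image-elim φ S j h | i , () | no ¬p | true
image-elim φ S j h | i , () | no ¬p | false

subset-ext : ∀ {n} (p q : Subset n) → (∀ i → lookup p i ≡ true → lookup q i ≡ true) →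
             (∀ i → lookup q i ≡ true → lookup p i ≡ true) → p ≡ q
subset-ext []      []      f g = refl
subset-ext (a ∷ p) (b ∷ q) f g = cong₂ _∷_ (heads a b (f zero) (g zero)) (subset-ext p q (f ∘ suc) (g ∘ suc))
  where
  heads : ∀ a b → (a ≡ true → b ≡ true) → (b ≡ true → a ≡ true) → a ≡ b
  heads true  b     f g = sym (f refl)
  heads false true  f g = g refl
  heads false false f g = refl

image-∘ : ∀ {s t n} (ψ : Fin t → Fin n) (φ : Fin s → Fin t) S → image ψ (image φ S) ≡ image (ψ ∘ φ) S
image-∘ ψ φ S = subset-ext _ _ to from
  where
  to : ∀ j → lookup (image ψ (image φ S)) j ≡ true → lookup (image (ψ ∘ φ) S) j ≡ true
  to j h with image-elim ψ (image φ S) j h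
  ... | i , h′ , refl with image-elim φ S i h′
  ...   | i′ , h″ , refl = image-intro (ψ ∘ φ) S i′ h″
  from : ∀ j → lookup (image (ψ ∘ φ) S) j ≡ true → lookup (image ψ (image φ S)) j ≡ true
  from j h with image-elim (ψ ∘ φ) S j h
  ... | i , h′ , refl = image-intro ψ (image φ S) (φ i) (image-intro φ S i h′)

image-cong : ∀ {t n} {φ φ′ : Fin t → Fin n} → (∀ i → φ i ≡ φ′ i) → ∀ S → image φ S ≡ image φ′ S
image-cong {φ = φ} {φ′} eq S = subset-ext _ _ (half φ φ′ eq) (half φ′ φ (sym ∘ eq))
  where
  half : ∀ φ φ′ → (∀ i → φ i ≡ φ′ i) → ∀ j → lookup (image φ S) j ≡ true → lookup (image φ′ S) j ≡ true
  half φ φ′ eq j h with image-elim φ S j h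
  ... | i , h′ , refl = subst (λ j → lookup (image φ′ S) j ≡ true) (sym (eq i)) (image-intro φ′ S i h′)

image-injective : ∀ {t n} {φ : Fin t → Fin n} → Injective _≡_ _≡_ φ → ∀ {S S′} → image φ S ≡ image φ S′ → S ≡ S′
image-injective {φ = φ} inj {S} {S′} eq = subset-ext S S′ (half S S′ eq) (half S′ S (sym eq))
  where
  half : ∀ S S′ → image φ S ≡ image φ S′ → ∀ i → lookup S i ≡ true → lookup S′ i ≡ true
  half S S′ eq i h with image-elim φ S′ (φ i) (subst (λ p → lookup p (φ i) ≡ true) eq (image-intro φ S i h))
  ... | i′ , h′ , φi′≡φi with inj φi′≡φi
  ...   | refl = h′

size-insert : ∀ {n} (f g : Fin n → Bool) a → f a ≡ false → g a ≡ true → (∀ j → j ≢ a → g j ≡ f j) →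
              ∣ tabulate g ∣ ≡ suc ∣ tabulate f ∣
size-insert f g zero fa ga eq rewrite fa | ga =
  cong (suc ∘ ∣_∣) (tabulate-cong (λ j → eq (suc j) (λ ())))
size-insert f g (suc a) fa ga eq rewrite eq zero (λ ()) with f zero
... | true  = cong suc (size-insert (f ∘ suc) (g ∘ suc) a fa ga (λ j j≢ → eq (suc j) (λ { refl → j≢ refl })))
... | false = size-insert (f ∘ suc) (g ∘ suc) a fa ga (λ j j≢ → eq (suc j) (λ { refl → j≢ refl }))

-- Induction on `t`: by injectivity `φ zero` is not in the image of the other elements, so a
-- selected first element adds exactly one point, which is the situation of `size-insert`.
∣image∣ : ∀ {t n} (φ : Fin t → Fin n) → Injective _≡_ _≡_ φ → ∀ S → ∣ image φ S ∣ ≡ ∣ S ∣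
∣image∣ {zero} {n} φ inj [] = trans (cong ∣_∣ (empty n)) (∣⊥∣≡0 n)
  where
  empty : ∀ n → tabulate {n = n} (λ _ → false) ≡ ⊥
  empty zero    = refl
  empty (suc n) = cong (false ∷_) (empty n)
∣image∣ {suc t} φ inj (false ∷ S) = ∣image∣ (φ ∘ suc) (λ e → Fin.suc-injective (inj e)) S
∣image∣ {suc t} φ inj (true ∷ S) =
  trans (size-insert _ _ (φ zero) absent present off) (cong suc (∣image∣ (φ ∘ suc) (λ e → Fin.suc-injective (inj e)) S))
  where
  rest : Fin _ → Bool
  rest j = anyFin (λ i → lookup S i ∧ ⌊ φ (suc i) Fin.≟ j ⌋)
  absent : rest (φ zero) ≡ false
  absent with rest (φ zero) in eq
  ... | false = refl
  ... | true with image-elim (φ ∘ suc) S (φ zero) (trans (lookup∘tabulate rest (φ zero)) eq)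
  ...   | i , _ , e with inj e
  ...     | ()
  present : (⌊ φ zero Fin.≟ φ zero ⌋ ∨ rest (φ zero)) ≡ true
  present rewrite ⌊≟⌋-refl (φ zero) = refl
  off : ∀ j → j ≢ φ zero → (⌊ φ zero Fin.≟ j ⌋ ∨ rest j) ≡ rest j
  off j j≢ with φ zero Fin.≟ j
  ... | yes p = ⊥-elim (j≢ (sym p))
  ... | no _  = refl

-- Inclusion of subsets

infix 4 _⊑_
_⊑_ : ∀ {n} → Subset n → Subset n → Bool
[]      ⊑ []      = true
(a ∷ p) ⊑ (b ∷ q) = (not a ∨ b) ∧ (p ⊑ q)

⊑-intro : ∀ {n} (p q : Subset n) → (∀ i → lookup p i ≡ true → lookup q i ≡ true) → (p ⊑ q) ≡ true
⊑-intro []          []      h = refl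
⊑-intro (true ∷ p)  (b ∷ q) h = ∧-introᵇ (h zero refl) (⊑-intro p q (h ∘ suc))
⊑-intro (false ∷ p) (b ∷ q) h = ⊑-intro p q (h ∘ suc)

⊑-++ : ∀ {m n} (r s : Subset m) (p q : Subset n) → (r Vec.++ p ⊑ s Vec.++ q) ≡ (r ⊑ s) ∧ (p ⊑ q)
⊑-++ []      []      p q = refl
⊑-++ (a ∷ r) (b ∷ s) p q rewrite ⊑-++ r s p q = sym (Bool.∧-assoc (not a ∨ b) (r ⊑ s) (p ⊑ q))

⊑-∪ : ∀ {n} (p q r : Subset n) → (p ⊑ r) ≡ true → (q ⊑ r) ≡ true → (p ∪ q ⊑ r) ≡ true
⊑-∪ []      []      []      h h′ = refl
⊑-∪ (a ∷ p) (b ∷ q) (c ∷ r) h h′ =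
  ∧-introᵇ (heads a b c (∧-elimˡ h) (∧-elimˡ h′)) (⊑-∪ p q r (∧-elimʳ {not a ∨ c} h) (∧-elimʳ {not b ∨ c} h′))
  where
  heads : ∀ a b c → (not a ∨ c) ≡ true → (not b ∨ c) ≡ true → (not (a ∨ b) ∨ c) ≡ true
  heads true  b c h h′ = h
  heads false b c h h′ = h′

⊑⇒∣∣≤ : ∀ {n} (p q : Subset n) → (p ⊑ q) ≡ true → ∣ p ∣ ≤ ∣ q ∣
⊑⇒∣∣≤ []          []          h = z≤n
⊑⇒∣∣≤ (true ∷ p)  (true ∷ q)  h = s≤s (⊑⇒∣∣≤ p q h)
⊑⇒∣∣≤ (false ∷ p) (true ∷ q)  h = m≤n⇒m≤1+n (⊑⇒∣∣≤ p q h)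
⊑⇒∣∣≤ (false ∷ p) (false ∷ q) h = ⊑⇒∣∣≤ p q h

⊑-same-size : ∀ {n} (p q : Subset n) → (p ⊑ q) ≡ true → ∣ p ∣ ≡ ∣ q ∣ → p ≡ q
⊑-same-size []          []          h e = refl
⊑-same-size (true ∷ p)  (true ∷ q)  h e = cong (true ∷_) (⊑-same-size p q h (suc-injective e))
⊑-same-size (false ∷ p) (true ∷ q)  h e = ⊥-elim (1+n≰n (subst (_≤ ∣ q ∣) e (⊑⇒∣∣≤ p q h)))
⊑-same-size (false ∷ p) (false ∷ q) h e = cong (false ∷_) (⊑-same-size p q h e)

⊑-or-bigger : ∀ {n} (p q : Subset n) → (q ⊑ p) ≡ true ⊎ ∣ p ∣ < ∣ p ∪ q ∣
⊑-or-bigger []      []      = inj₁ refl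
⊑-or-bigger (a ∷ p) (b ∷ q) with ⊑-or-bigger p q
⊑-or-bigger (true  ∷ p) (true  ∷ q) | inj₁ h = inj₁ h
⊑-or-bigger (true  ∷ p) (false ∷ q) | inj₁ h = inj₁ h
⊑-or-bigger (false ∷ p) (true  ∷ q) | inj₁ h = inj₂ (s≤s (∣p∣≤∣p∪q∣ p q))
⊑-or-bigger (false ∷ p) (false ∷ q) | inj₁ h = inj₁ h
⊑-or-bigger (true  ∷ p) (b     ∷ q) | inj₂ h = inj₂ (s≤s h)
⊑-or-bigger (false ∷ p) (true  ∷ q) | inj₂ h = inj₂ (m≤n⇒m≤1+n h)
⊑-or-bigger (false ∷ p) (false ∷ q) | inj₂ h = inj₂ h

-- The source of the extra factor `M` in the codegree bound: two distinct k-sets span at least k + 1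
-- points.
∣∪∣-distinct : ∀ {n} (p q : Subset n) → p ≢ q → ∣ p ∣ ≡ ∣ q ∣ → ∣ p ∣ < ∣ p ∪ q ∣
∣∪∣-distinct p q p≢q e with ⊑-or-bigger p q
... | inj₁ h = ⊥-elim (p≢q (sym (⊑-same-size q p h (sym e))))
... | inj₂ h = h

-- Transversals of the grid Fin R × Fin M

vecs : ∀ m n → List (Vec (Fin m) n)
vecs m zero    = [ [] ]
vecs m (suc n) = cartesianProductWith _∷_ (allFin m) (vecs m n)

∑-cartesianProductWith : ∀ {A B C : Set} (g : A → B → C) l m f →
                         ∑ (cartesianProductWith g l m) f ≡ ∑ l (λ a → ∑ m (λ b → f (g a b)))
∑-cartesianProductWith g []      m f = refl
∑-cartesianProductWith g (a ∷ l) m f =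
  trans (∑-++ (map (g a) m) (cartesianProductWith g l m) f)
        (cong₂ _+_ (∑-map (g a) m f) (∑-cartesianProductWith g l m f))

length-∑ : ∀ {A : Set} (l : List A) → length l ≡ ∑ l (λ _ → 1)
length-∑ l = sym (trans (∑-const l 1) (*-identityʳ _))

length-vecs : ∀ m n → length (vecs m n) ≡ m ^ n
length-vecs m zero    = refl
length-vecs m (suc n) = begin
  length (vecs m (suc n))                            ≡⟨ length-∑ (vecs m (suc n)) ⟩
  ∑ (vecs m (suc n)) (λ _ → 1)                       ≡⟨ ∑-cartesianProductWith _∷_ (allFin m) (vecs m n) _ ⟩
  ∑ (allFin m) (λ _ → ∑ (vecs m n) (λ _ → 1))        ≡⟨ ∑-const (allFin m) _ ⟩
  length (allFin m) * ∑ (vecs m n) (λ _ → 1)         ≡⟨ cong₂ _*_ (length-tabulate {n = m} id) (trans (sym (length-∑ (vecs m n))) (length-vecs m n)) ⟩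
  m * m ^ n                                          ∎
  where open Relation.Binary.PropositionalEquality.≡-Reasoning

∈-vecs : ∀ {m n} (x : Vec (Fin m) n) → x ∈ vecs m n
∈-vecs []      = here refl
∈-vecs (a ∷ x) = ∈-cartesianProductWith⁺ _∷_ (∈-allFin a) (∈-vecs x)

-- The point set of a transversal. Row `i` is the `i`-th block of length `m`, in agreement with
-- `combine` in `point`; concatenating the blocks lets inclusion be tested row by row.
graph : ∀ {m n} → Vec (Fin m) n → Subset (n * m)
graph []      = []
graph (a ∷ x) = ⁅ a ⁆ Vec.++ graph x

point : ∀ {m n} → Vec (Fin m) n → Fin n → Fin (n * m)
point x i = combine i (lookup x i)

point-injective : ∀ {m n} (x : Vec (Fin m) n) → Injective _≡_ _≡_ (point x)
point-injective x {i} {j} = combine-injectiveˡ i (lookup x i) j (lookup x j)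

point∈graph : ∀ {m n} (x : Vec (Fin m) n) i → lookup (graph x) (point x i) ≡ true
point∈graph (a ∷ x) zero    = trans (lookup-++ˡ ⁅ a ⁆ (graph x) a) (self a)
  where
  self : ∀ {n} (a : Fin n) → lookup ⁅ a ⁆ a ≡ true
  self zero    = refl
  self (suc a) = self a
point∈graph (a ∷ x) (suc i) = trans (lookup-++ʳ ⁅ a ⁆ (graph x) (point x i)) (point∈graph x i)

image-⊑-graph : ∀ {m n t} (x : Vec (Fin m) n) (φ : Fin t → Fin n) S → (image (point x ∘ φ) S ⊑ graph x) ≡ true
image-⊑-graph x φ S = ⊑-intro (image (point x ∘ φ) S) (graph x) inside
  where
  inside : ∀ j → lookup (image (point x ∘ φ) S) j ≡ true → lookup (graph x) j ≡ true
  inside j h with image-elim (point x ∘ φ) S j h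
  ... | i , _ , refl = point∈graph x (φ i)

∑-allFin-suc : ∀ n (f : Fin (suc n) → ℕ) → ∑ (allFin (suc n)) f ≡ f zero + ∑ (allFin n) (f ∘ suc)
∑-allFin-suc n f = cong (f zero +_) (trans (cong (λ l → ∑ l f) (sym (map-tabulate id suc))) (∑-map suc (allFin n) f))

-- The case of one row: `r` lies in all `n` singletons if it is empty, in one if it has one point,
-- and in none otherwise. These are the values of `cap`, and each of them satisfies the inequality.
count-⁅⁆ : ∀ {n} (r : Subset n) → ∑ (allFin n) (λ a → ι (r ⊑ ⁅ a ⁆)) * n ^ ∣ r ∣ ≤ n
count-⁅⁆ {n} r = ≤-trans (*-monoˡ-≤ (n ^ ∣ r ∣) (bound r)) (cap-^ n ∣ r ∣)
  where
  cap : ℕ → ℕ → ℕ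
  cap n zero          = n
  cap n (suc zero)    = 1
  cap n (suc (suc _)) = 0

  cap-^ : ∀ n c → cap n c * n ^ c ≤ n
  cap-^ n zero          = ≤-reflexive (*-identityʳ n)
  cap-^ n (suc zero)    = ≤-reflexive (trans (*-identityˡ (n * 1)) (*-identityʳ n))
  cap-^ n (suc (suc c)) = z≤n

  ⊑⊥ : ∀ {n} (r : Subset n) → ι (r ⊑ ⊥) ≤ cap 1 ∣ r ∣ × (∣ r ∣ ≢ 0 → ι (r ⊑ ⊥) ≡ 0)
  ⊑⊥ {n} r with r ⊑ ⊥ in h
  ... | false = z≤n , λ _ → refl
  ... | true with n≤0⇒n≡0 (≤-trans (⊑⇒∣∣≤ r ⊥ h) (≤-reflexive (∣⊥∣≡0 n)))
  ...   | e rewrite e = ≤-refl , λ ne → ⊥-elim (ne refl)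

  bound : ∀ {n} (r : Subset n) → ∑ (allFin n) (λ a → ι (r ⊑ ⁅ a ⁆)) ≤ cap n ∣ r ∣
  bound [] = z≤n
  bound {suc n} (true ∷ r) = begin
    ∑ (allFin (suc n)) (λ a → ι (true ∷ r ⊑ ⁅ a ⁆))  ≡⟨ ∑-allFin-suc n _ ⟩
    ι (r ⊑ ⊥) + ∑ (allFin n) (λ _ → 0)               ≡⟨ cong (ι (r ⊑ ⊥) +_) (trans (∑-const (allFin n) 0) (*-zeroʳ (length (allFin n)))) ⟩
    ι (r ⊑ ⊥) + 0                                    ≡⟨ +-identityʳ _ ⟩
    ι (r ⊑ ⊥)                                        ≤⟨ last ∣ r ∣ (⊑⊥ r) ⟩
    cap (suc n) (suc ∣ r ∣)                          ∎
    where
    open ≤-Reasoning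
    last : ∀ c {b} → ι b ≤ cap 1 c × (c ≢ 0 → ι b ≡ 0) → ι b ≤ cap (suc n) (suc c)
    last zero    (h , _) = h
    last (suc c) (_ , h) = ≤-reflexive (h (λ ()))
  bound {suc n} (false ∷ r) = begin
    ∑ (allFin (suc n)) (λ a → ι (false ∷ r ⊑ ⁅ a ⁆)) ≡⟨ ∑-allFin-suc n _ ⟩
    ι (r ⊑ ⊥) + ∑ (allFin n) (λ a → ι (r ⊑ ⁅ a ⁆))   ≤⟨ +-monoʳ-≤ (ι (r ⊑ ⊥)) (bound r) ⟩
    ι (r ⊑ ⊥) + cap n ∣ r ∣                          ≤⟨ last ∣ r ∣ (⊑⊥ r) ⟩
    cap (suc n) ∣ r ∣                                ∎
    where
    open ≤-Reasoning
    last : ∀ c {b} → ι b ≤ cap 1 c × (c ≢ 0 → ι b ≡ 0) → ι b + cap n c ≤ cap (suc n) c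
    last zero          (h , _) = +-monoˡ-≤ n h
    last (suc zero)    (_ , h) rewrite h (λ ()) = ≤-refl
    last (suc (suc c)) (_ , h) rewrite h (λ ()) = ≤-refl

∣++∣ : ∀ {m n} (r : Subset m) (p : Subset n) → ∣ r Vec.++ p ∣ ≡ ∣ r ∣ + ∣ p ∣
∣++∣ []          p = refl
∣++∣ (true ∷ r)  p = cong suc (∣++∣ r p)
∣++∣ (false ∷ r) p = ∣++∣ r p

-- Inclusion factors over the rows, so the counts of `count-⁅⁆` multiply. A set with two points in a
-- row lies in no transversal; otherwise each of its points fixes the column in one row. The power
-- is kept on the left to avoid subtracting in the exponent.
count-transversals : ∀ {m} n (w : Subset (n * m)) → ∑ (vecs m n) (λ x → ι (w ⊑ graph x)) * m ^ ∣ w ∣ ≤ m ^ n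
count-transversals zero    []  = ≤-refl
count-transversals {m} (suc n) w with Vec.splitAt m w
... | r , p , refl = begin
  ∑ (vecs m (suc n)) (λ x → ι (r Vec.++ p ⊑ graph x)) * m ^ ∣ r Vec.++ p ∣
    ≡⟨ cong₂ _*_ split (trans (cong (m ^_) (∣++∣ r p)) (^-distribˡ-+-* m ∣ r ∣ ∣ p ∣)) ⟩
  a * b * (m ^ ∣ r ∣ * m ^ ∣ p ∣)
    ≡⟨ rearrange a b (m ^ ∣ r ∣) (m ^ ∣ p ∣) ⟩
  (a * m ^ ∣ r ∣) * (b * m ^ ∣ p ∣)
    ≤⟨ *-mono-≤ (count-⁅⁆ r) (count-transversals n p) ⟩
  m * m ^ n ∎
  where
  open ≤-Reasoning
  a = ∑ (allFin m) (λ i → ι (r ⊑ ⁅ i ⁆))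
  b = ∑ (vecs m n) (λ x → ι (p ⊑ graph x))
  rearrange : ∀ a b c d → a * b * (c * d) ≡ (a * c) * (b * d)
  rearrange = solve-∀
  ι-∧ : ∀ b c → ι (b ∧ c) ≡ ι b * ι c
  ι-∧ true  c = sym (+-identityʳ (ι c))
  ι-∧ false c = refl
  split : ∑ (vecs m (suc n)) (λ x → ι (r Vec.++ p ⊑ graph x)) ≡ a * b
  split = trans (∑-cartesianProductWith _∷_ (allFin m) (vecs m n) _)
          (trans (∑-cong (allFin m) (λ i → trans (∑-cong (vecs m n) (λ x →
                    trans (cong ι (⊑-++ r ⁅ i ⁆ p (graph x))) (ι-∧ (r ⊑ ⁅ i ⁆) (p ⊑ graph x))))
                    (∑-*ˡ (vecs m n) _ (ι (r ⊑ ⁅ i ⁆)))))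
                 (∑-*ʳ (allFin m) _ b))

-- Containers

all-elim : ∀ {A : Set} (p : A → Bool) {l a} → all p l ≡ true → a ∈ l → p a ≡ true
all-elim p h (here refl) = ∧-elimˡ h
all-elim p {b ∷ l} h (there a∈l) = all-elim p (∧-elimʳ {p b} h) a∈l

-- X indexes the copies; under an assignment f the copy x has edges slot f i x.
record Setting : Set₁ where
  field
    {X W 𝔽}     : Set
    _≟_         : DecidableEquality W
    xs          : List X
    ws          : List W
    ws-unique   : Unique ws
    q ℓ s M D n J : ℕ
    slot        : (X → 𝔽) → Fin ℓ → X → W
  open Fibres _≟_ public

  ∣X∣ : ℕ
  ∣X∣ = length xs

  -- The factor by which the family of copies may shrink with each fixed edge. While fewer than a
  -- `1 / r` share of the family has been collected, the collected copies and those lost to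
  -- saturated edges make up at most half of it.
  r : ℕ
  r = 6 * ℓ * s

  uncovered : (Fin q → W → Bool) → W → Bool
  uncovered C w = not (anyFin (λ c → C c w))

  # : (X → Bool) → ℕ
  # h = ∑ xs (ι ∘ h)

  field
    q≥1      : 1 ≤ q
    ℓ≥1      : 1 ≤ ℓ
    s≥1      : 1 ≤ s
    D≥1      : 1 ≤ D
    n≥1      : 1 ≤ n
    ∣X∣≥1    : 1 ≤ ∣X∣
    -- Keeps the codegree bound `∣X∣ / (D * M)` below the degree scale `∣X∣ / (D * s ^ a)` at every
    -- level `a ≤ ℓ`.
    s^ℓ≤M    : s ^ ℓ ≤ M
    ∣ws∣≤n   : length ws ≤ n
    -- Guarantees that `J` positive answers suffice to fix one edge.
    4n≤Jr    : 4 * n ≤ J * r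
    slot∈    : ∀ f i x → slot f i x ∈ ws
    degree   : ∀ f i w → deg xs (slot f i) (const true) w * D ≤ ∣X∣
    codegree : ∀ f i j → i ≢ j → ∀ w v →
               ∑ xs (λ x → ι ((slot f i x == w) ∧ (slot f j x == v))) * (D * M) ≤ ∣X∣
    ramsey   : ∀ (C : Fin q → W → Bool) → D ≤ 2 * ∑ ws (ι ∘ uncovered C) ⊎
               (Σ (X → 𝔽) λ f → Σ (Fin q) λ c → Σ (X → Bool) λ h → ∣X∣ ≤ # h * (2 * q) ×
                 (∀ x → h x ≡ true → ∀ i → C c (slot f i x) ≡ true))

module Containers (S : Setting) where
  open Setting S

  -- With `a` edges fixed, the family still has at least `∣X∣ / β a` copies, and a k-set serves as a
  -- given unfixed edge in at most `2 * ∣X∣ / μ a` of them. At `a = 0` these are the bounds supplied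
  -- by `ramsey` and `degree`.
  β μ : ℕ → ℕ
  β a = 2 * q * r ^ a
  μ a = D * s ^ a

  -- A stuck exploration removes at least `D / γ` k-sets from a container. It matters that `γ` does
  -- not involve `s`: the number of rounds must be bounded before `s` is chosen.
  γ : ℕ
  γ = 16 * q * (6 * ℓ) ^ ℓ

  r≥1 : 1 ≤ r
  r≥1 = *-mono-≤ {1} {6 * ℓ} (*-mono-≤ {1} {6} (s≤s z≤n) ℓ≥1) s≥1

  instance
    nz-D : NonZero D
    nz-D = >-nonZero D≥1
    nz-s : NonZero s
    nz-s = >-nonZero s≥1
    nz-ℓ : NonZero ℓ
    nz-ℓ = >-nonZero ℓ≥1
    nz-n : NonZero n
    nz-n = >-nonZero n≥1
    nz-X : NonZero ∣X∣
    nz-X = >-nonZero ∣X∣≥1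
    nz-r : NonZero r
    nz-r = >-nonZero r≥1

  nz-μ : ∀ a → NonZero (μ a)
  nz-μ a = m*n≢0 D (s ^ a) {{nz-D}} {{m^n≢0 s a}}

  -- Fixing one more edge of the copies

  module Phase (f : X → 𝔽) (C : W → Bool) where

    degᵢ : Fin ℓ → (X → Bool) → W → ℕ
    degᵢ i = deg xs (slot f i)

    Big : ℕ → (X → Bool) → Set
    Big a h = ∣X∣ ≤ # h * β a

    Capped : ℕ → List (Fin ℓ) → (X → Bool) → Set
    Capped a is h = ∀ i → i ∈ is → ∀ w → degᵢ i h w * μ a ≤ 2 * ∣X∣

    -- h is the family of copies whose a first edges are fixed, and h′ ⊆ h the subfamily built so far
    -- whose next edge e is fixed too. An edge is saturated once it lies in so many copies of h′ that
    -- adding more would violate the degree bound of the next level.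
    module Step (a : ℕ) (e : Fin ℓ) (es : List (Fin ℓ)) (h h′ : X → Bool) where

      sat : Fin ℓ → W → Bool
      sat i v = ∣X∣ ≤ᵇ degᵢ i h′ v * μ (suc a)

      clear rem : X → Bool
      clear x = all (λ i → not (sat i (slot f i x))) es
      rem x   = h x ∧ not (h′ x) ∧ clear x

      query : W → Bool
      query w = ∣X∣ ≤ᵇ degᵢ e rem w * (4 * n * β a)

      enlarge : W → X → Bool
      enlarge w x = h′ x ∨ (rem x ∧ (slot f e x == w))

      rem⇒h : ∀ x → rem x ≡ true → h x ≡ true
      rem⇒h x = ∧-elimˡ

      -- A saturated `w` has degree at least `∣X∣ / μ (suc a)` in `h′` and at most `2 * ∣X∣ / μ a`
      -- in `h`, hence at most `2 * s` times as much. Summed over `w`, the degrees in `h′` give at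
      -- most `# h′`.
      lost-≤ : ∀ i → (∀ w → degᵢ i h w * μ a ≤ 2 * ∣X∣) →
               ∑ xs (λ x → ι (h x ∧ sat i (slot f i x))) ≤ 2 * s * # h′
      lost-≤ i cap = *-cancelʳ-≤ lost (2 * s * # h′) (μ a) {{nz-μ a}} (begin
        lost * μ a
          ≤⟨ *-monoˡ-≤ (μ a) (fibre-≤ xs (slot f i) ws h (sat i) (slot∈ f i)) ⟩
        ∑ ws (λ w → ι (sat i w) * degᵢ i h w) * μ a
          ≡⟨ ∑-*ʳ ws _ (μ a) ⟨
        ∑ ws (λ w → ι (sat i w) * degᵢ i h w * μ a)
          ≤⟨ ∑-mono ws (λ w → ≤-trans (≤-reflexive (*-assoc (ι (sat i w)) _ _)) (*-monoʳ-≤ (ι (sat i w)) (cap w))) ⟩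
        ∑ ws (λ w → ι (sat i w) * (2 * ∣X∣))
          ≤⟨ ∑-mono ws saturated ⟩
        ∑ ws (λ w → degᵢ i h′ w * (2 * μ (suc a)))
          ≡⟨ ∑-*ʳ ws _ (2 * μ (suc a)) ⟩
        ∑ ws (degᵢ i h′) * (2 * μ (suc a))
          ≤⟨ *-monoˡ-≤ (2 * μ (suc a)) (fibre-≥ xs (slot f i) h′ ws-unique) ⟩
        # h′ * (2 * μ (suc a))
          ≡⟨ rearrange (# h′) D s (s ^ a) ⟩
        2 * s * # h′ * μ a ∎)
        where
        open ≤-Reasoning
        lost = ∑ xs (λ x → ι (h x ∧ sat i (slot f i x)))
        rearrange : ∀ k d s t → k * (2 * (d * (s * t))) ≡ 2 * s * k * (d * t)
        rearrange = solve-∀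
        saturated : ∀ w → ι (sat i w) * (2 * ∣X∣) ≤ degᵢ i h′ w * (2 * μ (suc a))
        saturated w with sat i w in eq
        ... | false = z≤n
        ... | true  = begin
          1 * (2 * ∣X∣)                    ≡⟨ *-identityˡ _ ⟩
          2 * ∣X∣                          ≤⟨ *-monoʳ-≤ 2 (≤ᵇ-true ∣X∣ (degᵢ i h′ w * μ (suc a)) eq) ⟩
          2 * (degᵢ i h′ w * μ (suc a))    ≡⟨ swap (degᵢ i h′ w) (μ (suc a)) ⟩
          degᵢ i h′ w * (2 * μ (suc a))    ∎
          where
          swap : ∀ d m → 2 * (d * m) ≡ d * (2 * m)
          swap = solve-∀

      h-≤ : Capped a es h → # h ≤ # rem + (# h′ + length es * (2 * s * # h′))
      h-≤ caps = begin
        # h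
          ≤⟨ ∑-mono xs pointwise ⟩
        ∑ xs (λ x → ι (rem x) + (ι (h′ x) + ∑ es (λ i → ι (h x ∧ sat i (slot f i x)))))
          ≡⟨ trans (∑-+ xs _ _) (cong (# rem +_) (∑-+ xs _ _)) ⟩
        # rem + (# h′ + ∑ xs (λ x → ∑ es (λ i → ι (h x ∧ sat i (slot f i x)))))
          ≡⟨ cong (λ z → # rem + (# h′ + z)) (∑-swap xs es _) ⟩
        # rem + (# h′ + ∑ es (λ i → ∑ xs (λ x → ι (h x ∧ sat i (slot f i x)))))
          ≤⟨ +-monoʳ-≤ (# rem) (+-monoʳ-≤ (# h′) (∑-mono-∈ es (λ i i∈ → lost-≤ i (caps i i∈)))) ⟩
        # rem + (# h′ + ∑ es (λ i → 2 * s * # h′))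
          ≡⟨ cong (λ z → # rem + (# h′ + z)) (∑-const es _) ⟩
        # rem + (# h′ + length es * (2 * s * # h′)) ∎
        where
        open ≤-Reasoning
        all-or-lost : ∀ x is → 1 ≤ ι (all (λ i → not (sat i (slot f i x))) is) + ∑ is (λ i → ι (sat i (slot f i x)))
        all-or-lost x []       = ≤-refl
        all-or-lost x (i ∷ is) with sat i (slot f i x)
        ... | true  = s≤s z≤n
        ... | false = all-or-lost x is
        pointwise : ∀ x → ι (h x) ≤ ι (rem x) + (ι (h′ x) + ∑ es (λ i → ι (h x ∧ sat i (slot f i x))))
        pointwise x with h x | h′ x
        ... | false | _     = z≤n
        ... | true  | true  = s≤s z≤n
        ... | true  | false = all-or-lost x es

      module _ (big : Big a h) (small : # h′ * β (suc a) < ∣X∣) where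

        h′*r<h : # h′ * r < # h
        h′*r<h = *-cancelʳ-< (β a) (# h′ * r) (# h) (begin-strict
          # h′ * r * β a    ≡⟨ rearrange (# h′) r q (r ^ a) ⟩
          # h′ * β (suc a)  <⟨ small ⟩
          ∣X∣               ≤⟨ big ⟩
          # h * β a         ∎)
          where
          open ≤-Reasoning
          rearrange : ∀ k r q t → k * r * (2 * q * t) ≡ k * (2 * q * (r * t))
          rearrange = solve-∀

        -- By `h-≤` a copy of `h` outside `rem` is in `h′` or is lost to saturation, which accounts
        -- for at most `3 * ℓ * s * # h′` copies; twice this is `# h′ * r`, which is below `# h`.
        half-≤-rem : Capped a es h → length es ≤ ℓ → # h ≤ 2 * # rem
        half-≤-rem caps es≤ = +-cancelʳ-≤ (# h) (# h) (2 * # rem) (begin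
          # h + # h
            ≡⟨ cong (# h +_) (+-identityʳ (# h)) ⟨
          2 * # h
            ≤⟨ *-monoʳ-≤ 2 (h-≤ caps) ⟩
          2 * (# rem + (# h′ + length es * (2 * s * # h′)))
            ≤⟨ *-monoʳ-≤ 2 (+-monoʳ-≤ (# rem) (+-mono-≤ k≤ (*-monoˡ-≤ (2 * s * # h′) es≤))) ⟩
          2 * (# rem + (ℓ * s * # h′ + ℓ * (2 * s * # h′)))
            ≡⟨ rearrange (# rem) ℓ s (# h′) ⟩
          2 * # rem + # h′ * r
            ≤⟨ +-monoʳ-≤ (2 * # rem) (<⇒≤ h′*r<h) ⟩
          2 * # rem + # h ∎)
          where
          open ≤-Reasoning
          k≤ : # h′ ≤ ℓ * s * # h′
          k≤ = m≤n*m (# h′) (ℓ * s) {{m*n≢0 ℓ s}}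
          rearrange : ∀ m l s k → 2 * (m + (l * s * k + l * (2 * s * k))) ≡ 2 * m + k * (6 * l * s)
          rearrange = solve-∀

        -- `rem` has at least `∣X∣ / (2 * β a)` copies. The k-sets failing `query` number at most
        -- `n` and carry at most half of that. Each of the others carries at most `2 * ∣X∣ / μ a`,
        -- so there are at least `μ a / (8 * β a)` of them, and in this quotient the powers of `s`
        -- cancel.
        query-large : Capped a (e ∷ es) h → length es ≤ ℓ → a ≤ ℓ →
                      (∀ x → h x ≡ true → C (slot f e x) ≡ true) →
                      D ≤ γ * ∑ ws (λ w → ι (query w ∧ C w))
        query-large caps es≤ a≤ inC = *-cancelʳ-≤ D (γ * A) (s ^ a) {{m^n≢0 s a}} (begin
          μ a                                    ≤⟨ μ≤ ⟩
          8 * β a * A                            ≡⟨ cong (λ z → 8 * (2 * q * z) * A) (^-distribʳ-* a (6 * ℓ) s) ⟩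
          8 * (2 * q * ((6 * ℓ) ^ a * s ^ a)) * A ≡⟨ rearrange q ((6 * ℓ) ^ a) (s ^ a) A ⟩
          16 * q * A * s ^ a * (6 * ℓ) ^ a       ≤⟨ *-monoʳ-≤ (16 * q * A * s ^ a) (^-monoʳ-≤ (6 * ℓ) {{m*n≢0 6 ℓ}} a≤) ⟩
          16 * q * A * s ^ a * (6 * ℓ) ^ ℓ       ≡⟨ rearrange′ q A (s ^ a) ((6 * ℓ) ^ ℓ) ⟩
          γ * A * s ^ a                          ∎)
          where
          open ≤-Reasoning
          A = ∑ ws (λ w → ι (query w ∧ C w))
          Θ = 4 * n * β a
          rearrange : ∀ q l t A → 8 * (2 * q * (l * t)) * A ≡ 16 * q * A * t * l
          rearrange = solve-∀
          rearrange′ : ∀ q A t l → 16 * q * A * t * l ≡ 16 * q * l * A * t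
          rearrange′ = solve-∀

          pointwise : ∀ w → degᵢ e rem w * (Θ * μ a) ≤ ∣X∣ * μ a + ι (query w ∧ C w) * (2 * ∣X∣ * Θ)
          pointwise w with query w in eq
          ... | false = begin
            degᵢ e rem w * (Θ * μ a) ≡⟨ *-assoc (degᵢ e rem w) Θ (μ a) ⟨
            degᵢ e rem w * Θ * μ a   ≤⟨ *-monoˡ-≤ (μ a) (<⇒≤ (≤ᵇ-false ∣X∣ (degᵢ e rem w * Θ) eq)) ⟩
            ∣X∣ * μ a                ≡⟨ +-identityʳ _ ⟨
            ∣X∣ * μ a + 0            ∎
          ... | true with C w in eqC
          ...   | true = begin
            degᵢ e rem w * (Θ * μ a)             ≤⟨ *-monoˡ-≤ (Θ * μ a) (∑-mono xs (λ x → ι-mono (λ p → ∧-introᵇ (rem⇒h x (∧-elimˡ p)) (∧-elimʳ {rem x} p)))) ⟩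
            degᵢ e h w * (Θ * μ a)               ≡⟨ rearr (degᵢ e h w) Θ (μ a) ⟩
            degᵢ e h w * μ a * Θ                 ≤⟨ *-monoˡ-≤ Θ (caps e (here refl) w) ⟩
            2 * ∣X∣ * Θ                          ≡⟨ *-identityˡ (2 * ∣X∣ * Θ) ⟨
            1 * (2 * ∣X∣ * Θ)                    ≤⟨ m≤n+m _ (∣X∣ * μ a) ⟩
            ∣X∣ * μ a + 1 * (2 * ∣X∣ * Θ)        ∎
            where
            rearr : ∀ a b c → a * (b * c) ≡ a * c * b
            rearr = solve-∀
          -- All copies in `h` lie inside `C`, so a k-set outside `C` has degree zero in `rem`.
          ...   | false = ≤-trans (≤-reflexive (cong (_* (Θ * μ a)) empty)) z≤n
            where
            none : ∀ x → ι (rem x ∧ (slot f e x == w)) ≡ 0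
            none x with rem x ∧ (slot f e x == w) in p
            ... | false = refl
            ... | true with trans (sym (inC x (rem⇒h x (∧-elimˡ p)))) (trans (cong C (==⇒≡ (∧-elimʳ {rem x} p))) eqC)
            ...   | ()
            empty : degᵢ e rem w ≡ 0
            empty = trans (∑-cong xs none) (trans (∑-const xs 0) (*-zeroʳ ∣X∣))

          total : # rem * (Θ * μ a) ≤ n * (∣X∣ * μ a) + A * (2 * ∣X∣ * Θ)
          total = begin
            # rem * (Θ * μ a)
              ≤⟨ *-monoˡ-≤ (Θ * μ a) rem≤ ⟩
            ∑ ws (degᵢ e rem) * (Θ * μ a)
              ≡⟨ ∑-*ʳ ws _ _ ⟨
            ∑ ws (λ w → degᵢ e rem w * (Θ * μ a))
              ≤⟨ ∑-mono ws pointwise ⟩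
            ∑ ws (λ w → ∣X∣ * μ a + ι (query w ∧ C w) * (2 * ∣X∣ * Θ))
              ≡⟨ trans (∑-+ ws _ _) (cong₂ _+_ (∑-const ws _) (∑-*ʳ ws _ _)) ⟩
            length ws * (∣X∣ * μ a) + A * (2 * ∣X∣ * Θ)
              ≤⟨ +-monoˡ-≤ (A * (2 * ∣X∣ * Θ)) (*-monoˡ-≤ (∣X∣ * μ a) ∣ws∣≤n) ⟩
            n * (∣X∣ * μ a) + A * (2 * ∣X∣ * Θ) ∎
            where
            rem≤ : # rem ≤ ∑ ws (degᵢ e rem)
            rem≤ = ≤-trans (∑-mono xs (λ x → ι-mono (λ p → ∧-introᵇ p refl)))
                   (≤-trans (fibre-≤ xs (slot f e) ws rem (const true) (slot∈ f e))
                            (≤-reflexive (∑-cong ws (λ w → *-identityˡ _))))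

          lower : 2 * n * (∣X∣ * μ a) ≤ # rem * (Θ * μ a)
          lower = begin
            2 * n * (∣X∣ * μ a)                 ≤⟨ *-monoʳ-≤ (2 * n) (*-monoˡ-≤ (μ a) (≤-trans big (*-monoˡ-≤ (β a) (half-≤-rem (λ i → caps i ∘ there) es≤)))) ⟩
            2 * n * (2 * # rem * β a * μ a)     ≡⟨ rearr n (# rem) (β a) (μ a) ⟩
            # rem * (Θ * μ a)                   ∎
            where
            rearr : ∀ n m b c → 2 * n * (2 * m * b * c) ≡ m * (4 * n * b * c)
            rearr = solve-∀

          μ≤ : μ a ≤ 8 * β a * A
          μ≤ = *-cancelˡ-≤ (n * ∣X∣) {{m*n≢0 n ∣X∣}} (+-cancelˡ-≤ (n * (∣X∣ * μ a)) _ _ (begin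
            n * (∣X∣ * μ a) + n * ∣X∣ * μ a            ≡⟨ rearr₁ n ∣X∣ (μ a) ⟩
            2 * n * (∣X∣ * μ a)                        ≤⟨ ≤-trans lower total ⟩
            n * (∣X∣ * μ a) + A * (2 * ∣X∣ * Θ)        ≡⟨ cong (n * (∣X∣ * μ a) +_) (rearr₂ A ∣X∣ n (β a)) ⟩
            n * (∣X∣ * μ a) + n * ∣X∣ * (8 * β a * A)  ∎))
            where
            rearr₁ : ∀ n x m → n * (x * m) + n * x * m ≡ 2 * n * (x * m)
            rearr₁ = solve-∀
            rearr₂ : ∀ A x n b → A * (2 * x * (4 * n * b)) ≡ n * x * (8 * b * A)
            rearr₂ = solve-∀

      enlarge-size : ∀ w → # (enlarge w) ≡ # h′ + degᵢ e rem w
      enlarge-size w = trans (∑-cong xs pointwise) (∑-+ xs _ _)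
        where
        pointwise : ∀ x → ι (enlarge w x) ≡ ι (h′ x) + ι (rem x ∧ (slot f e x == w))
        pointwise x with h x | h′ x
        ... | true  | true  = refl
        ... | true  | false = refl
        ... | false | true  = refl
        ... | false | false = refl

      -- If `v` is saturated, `clear` keeps new copies away from it. If not, its old degree is below
      -- `∣X∣ / μ (suc a)`, and every new copy through `v` also has the edge `w`, so `codegree` adds
      -- at most `∣X∣ / (D * M)`.
      enlarge-capped : ∀ w → All (e ≢_) es → suc a ≤ ℓ → Capped (suc a) es h′ → Capped (suc a) es (enlarge w)
      enlarge-capped w e∉ a<ℓ caps i i∈ v with sat i v in eq
      ... | true = ≤-trans (*-monoˡ-≤ (μ (suc a)) (∑-mono xs (λ x → ι-mono (same x)))) (caps i i∈ v)
        where
        same : ∀ x → enlarge w x ∧ (slot f i x == v) ≡ true → h′ x ∧ (slot f i x == v) ≡ true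
        same x p with h′ x
        ... | true  = p
        ... | false with trans (sym (all-elim _ (∧-elimʳ {true} (∧-elimʳ {h x} (∧-elimˡ {b = slot f e x == w} (∧-elimˡ p)))) i∈))
                               (trans (cong (not ∘ sat i) (==⇒≡ (∧-elimʳ {(h x ∧ true ∧ clear x) ∧ (slot f e x == w)} p))) (cong not eq))
        ...   | ()
      ... | false = begin
        degᵢ i (enlarge w) v * μ (suc a)              ≤⟨ *-monoˡ-≤ (μ (suc a)) (≤-trans (∑-mono xs split) (≤-reflexive (∑-+ xs _ _))) ⟩
        (degᵢ i h′ v + both) * μ (suc a)              ≡⟨ *-distribʳ-+ (μ (suc a)) (degᵢ i h′ v) both ⟩
        degᵢ i h′ v * μ (suc a) + both * μ (suc a)    ≤⟨ +-mono-≤ (<⇒≤ (≤ᵇ-false ∣X∣ (degᵢ i h′ v * μ (suc a)) eq)) (*-monoʳ-≤ both (*-monoʳ-≤ D s^a≤M)) ⟩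
        ∣X∣ + both * (D * M)                          ≤⟨ +-monoʳ-≤ ∣X∣ (codegree f e i (All.lookup e∉ i∈) w v) ⟩
        ∣X∣ + ∣X∣                                     ≡⟨ cong (∣X∣ +_) (+-identityʳ ∣X∣) ⟨
        2 * ∣X∣                                       ∎
        where
        open ≤-Reasoning
        both = ∑ xs (λ x → ι ((slot f e x == w) ∧ (slot f i x == v)))
        s^a≤M : s ^ suc a ≤ M
        s^a≤M = ≤-trans (^-monoʳ-≤ s a<ℓ) s^ℓ≤M
        split : ∀ x → ι (enlarge w x ∧ (slot f i x == v)) ≤
                      ι (h′ x ∧ (slot f i x == v)) + ι ((slot f e x == w) ∧ (slot f i x == v))
        split x with h′ x
        ... | true = m≤m+n _ _
        ... | false with h x ∧ true ∧ clear x
        ...   | true  = ≤-refl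
        ...   | false = z≤n

  -- Exploration trees

  Coloured : Set
  Coloured = List W × (W → Fin q)

  In : Coloured → Fin q → W → Set
  In (G , χ) c w = w ∈ G × χ w ≡ c

  -- A strategy for exploring an unknown coloured hypergraph ω with at most L queries, each of
  -- which asks for an edge of colour c satisfying Q; K is what is already known about ω.
  data Tree : ℕ → (Coloured → Set) → Set₁ where
    absurd : ∀ {L K} → (∀ ω → ¬ K ω) → Tree L K
    avoids : ∀ {L K} (U : W → Bool) → D ≤ 2 * ∑ ws (ι ∘ U) →
             (∀ ω → K ω → ∀ c w → In ω c w → U w ≡ false) → Tree L K
    mono   : ∀ {L K} (f : X → 𝔽) c (h : X → Bool) → ∣X∣ ≤ # h * β ℓ →
             (∀ ω → K ω → ∀ x → h x ≡ true → ∀ i → In ω c (slot f i x)) → Tree L K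
    ask    : ∀ {L L′ K} → L < L′ → ∀ c (Q : W → Bool) →
             Tree L (λ ω → K ω × (∀ w → In ω c w → Q w ≡ false)) →
             (∀ w → Tree L (λ ω → K ω × In ω c w × Q w ≡ true)) → Tree L′ K

  weaken : ∀ {L L′ K} → L ≤ L′ → Tree L K → Tree L′ K
  weaken L≤ (absurd k)         = absurd k
  weaken L≤ (avoids U big k)   = avoids U big k
  weaken L≤ (mono f c h big k) = mono f c h big k
  weaken L≤ (ask L< c Q t ts)  = ask (<-≤-trans L< L≤) c Q t ts

  Containing : (Fin q → W → Bool) → (Coloured → Set) → Set
  Containing C K = ∀ ω → K ω → ∀ c w → In ω c w → C c w ≡ true

  -- One round with a fixed colour and fixed containers. The continuation after a negative answer is
  -- the parameter `shrunk`, which separates the recursion over edges from the recursion over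
  -- containers.
  module Shrink (f : X → 𝔽) (c : Fin q) (C : Fin q → W → Bool) (L₀ : ℕ)
    (shrunk : ∀ {K : Coloured → Set} → Containing C K → ∀ (Q : W → Bool) → D ≤ γ * ∑ ws (λ w → ι (Q w ∧ C c w)) →
              Tree L₀ (λ ω → K ω × (∀ w → In ω c w → Q w ≡ false))) where

    open Phase f (C c)

    Inside : (X → Bool) → Set
    Inside h = ∀ x → h x ≡ true → ∀ i → C c (slot f i x) ≡ true

    Known : (Coloured → Set) → List (Fin ℓ) → (X → Bool) → Set
    Known K es h = ∀ ω → K ω → ∀ x → h x ≡ true → ∀ i → i ∉ es → In ω c (slot f i x)

    -- Outer loop over the edges `es` still to be fixed. The budget allows `J` positive answers for
    -- each of them and, in `suc L₀`, one negative answer followed by the continuation.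
    level : ∀ es a → Unique es → length es + a ≡ ℓ → ∀ h → Big a h → Capped a es h → Inside h →
            ∀ {K} → Containing C K → Known K es h → Tree (length es * J + suc L₀) K
    -- Inner loop: collects k-sets for the edge `e` until `h′` is large enough to serve as the next
    -- level. `j` is the number of positive answers left; the last hypothesis records that each
    -- answer so far contributed at least `∣X∣ / (4 * n * β a)` copies.
    select : ∀ e es a → Unique (e ∷ es) → suc (length es + a) ≡ ℓ → ∀ h → Big a h →
             Capped a (e ∷ es) h → Inside h → ∀ {K} → Containing C K → Known K (e ∷ es) h →
             ∀ j h′ → # h′ * β (suc a) < ∣X∣ → Capped (suc a) es h′ → Inside h′ → Known K es h′ →
             J * ∣X∣ ≤ # h′ * (4 * n * β a) + j * ∣X∣ → Tree (j + (length es * J + suc L₀)) K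

    level [] a u refl h big caps inside K⊆C known = mono f c h big (λ ω k x hx i → known ω k x hx i (λ ()))
    level (e ∷ es) a u len h big caps inside K⊆C known =
      weaken (≤-reflexive (sym (+-assoc J (length es * J) (suc L₀))))
        (select e es a u len h big caps inside K⊆C known J (const false)
          (subst (λ z → z * β (suc a) < ∣X∣) (sym empty) ∣X∣≥1)
          (λ i _ w → subst (λ z → z * μ (suc a) ≤ 2 * ∣X∣) (sym empty) z≤n)
          (λ x ()) (λ ω k x ())
          (m≤n+m (J * ∣X∣) _))
      where
      empty : ∑ xs (λ _ → 0) ≡ 0
      empty = trans (∑-const xs 0) (*-zeroʳ ∣X∣)

    -- After `J` answers the recorded progress and `4n≤Jr` would give `h′` at least
    -- `∣X∣ / β (suc a)` copies, contrary to `small`.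
    select e es a u len h big caps inside K⊆C known zero h′ small caps′ inside′ known′ progress =
      ⊥-elim (<-irrefl refl (begin-strict
        J * ∣X∣ * r                           ≤⟨ *-monoˡ-≤ r progress ⟩
        (# h′ * (4 * n * β a) + 0) * r        ≡⟨ rearrange (# h′) n q (r ^ a) r ⟩
        4 * n * (# h′ * β (suc a))            <⟨ *-monoʳ-< (4 * n) {{m*n≢0 4 n}} small ⟩
        4 * n * ∣X∣                           ≤⟨ *-monoˡ-≤ ∣X∣ 4n≤Jr ⟩
        J * r * ∣X∣                           ≡⟨ rearrange′ J r ∣X∣ ⟩
        J * ∣X∣ * r                           ∎))
      where
      open ≤-Reasoning
      rearrange : ∀ k n q t r → (k * (4 * n * (2 * q * t)) + 0) * r ≡ 4 * n * (k * (2 * q * (r * t)))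
      rearrange = solve-∀
      rearrange′ : ∀ a b c → a * b * c ≡ a * c * b
      rearrange′ = solve-∀
    select e es a u@(e∉es ∷ u′) len h big caps inside {K} K⊆C known (suc j) h′ small caps′ inside′ known′ progress =
      ask ≤-refl c query
        (weaken (≤-trans (n≤1+n L₀) (≤-trans (m≤n+m (suc L₀) (length es * J)) (m≤n+m _ j)))
          (shrunk K⊆C query (query-large big small caps es≤ℓ a≤ℓ (λ x hx → inside x hx e))))
        next
      where
      open Step a e es h h′
      es≤ℓ : length es ≤ ℓ
      es≤ℓ = ≤-trans (≤-trans (m≤m+n (length es) a) (n≤1+n _)) (≤-reflexive len)
      a<ℓ : suc a ≤ ℓ
      a<ℓ = ≤-trans (s≤s (m≤n+m a (length es))) (≤-reflexive len)
      a≤ℓ : a ≤ ℓ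
      a≤ℓ = ≤-trans (n≤1+n a) a<ℓ
      capped : ∀ w → Capped (suc a) es (enlarge w)
      capped w = enlarge-capped w e∉es a<ℓ caps′
      inside″ : ∀ w → Inside (enlarge w)
      inside″ w x p with h′ x in eq
      ... | true  = inside′ x eq
      ... | false = inside x (∧-elimˡ (∧-elimˡ p))
      known″ : ∀ w {b} → Known (λ ω → K ω × In ω c w × b ≡ true) es (enlarge w)
      known″ w ω (k , inw , _) x p i i∉ with h′ x in eq
      ... | true  = known′ ω k x eq i i∉
      ... | false with i Fin.≟ e
      ...   | yes refl = subst (In ω c) (sym (==⇒≡ (∧-elimʳ {h x ∧ true ∧ clear x} p))) inw
      ...   | no i≢e   = known ω k x (∧-elimˡ (∧-elimˡ p)) i (λ { (here i≡e) → i≢e i≡e ; (there i∈) → i∉ i∈ })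
      next : ∀ w → Tree (j + (length es * J + suc L₀)) (λ ω → K ω × In ω c w × query w ≡ true)
      next w with query w in qw
      ... | false = absurd (λ { ω (_ , _ , ()) })
      ... | true with ∣X∣ ≤? # (enlarge w) * β (suc a)
      ...   | yes big′ = weaken (m≤n+m _ j)
                (level es (suc a) u′ (trans (+-suc (length es) a) len) (enlarge w) big′ (capped w) (inside″ w) (λ ω → K⊆C ω ∘ proj₁) (known″ w))
      ...   | no ¬big  = select e es a u len h big caps inside (λ ω → K⊆C ω ∘ proj₁) (λ ω → known ω ∘ proj₁)
                j (enlarge w) (≰⇒> ¬big) (capped w) (inside″ w) (known″ w) progress′
        where
        open ≤-Reasoning
        progress′ : J * ∣X∣ ≤ # (enlarge w) * (4 * n * β a) + j * ∣X∣
        progress′ = begin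
          J * ∣X∣                                                           ≤⟨ progress ⟩
          # h′ * (4 * n * β a) + (∣X∣ + j * ∣X∣)                            ≡⟨ +-assoc _ ∣X∣ (j * ∣X∣) ⟨
          # h′ * (4 * n * β a) + ∣X∣ + j * ∣X∣                              ≤⟨ +-monoˡ-≤ (j * ∣X∣) (+-monoʳ-≤ _ (≤ᵇ-true ∣X∣ (degᵢ e rem w * (4 * n * β a)) qw)) ⟩
          # h′ * (4 * n * β a) + degᵢ e rem w * (4 * n * β a) + j * ∣X∣     ≡⟨ cong (_+ j * ∣X∣) (*-distribʳ-+ (4 * n * β a) (# h′) _) ⟨
          (# h′ + degᵢ e rem w) * (4 * n * β a) + j * ∣X∣                   ≡⟨ cong (λ z → z * (4 * n * β a) + j * ∣X∣) (enlarge-size w) ⟨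
          # (enlarge w) * (4 * n * β a) + j * ∣X∣                           ∎

  -- Repeated shrinking of the containers

  private module Finᶠ = Fibres (Fin._≟_ {q})

  mass : (Fin q → W → Bool) → ℕ
  mass C = ∑ (allFin q) (λ c → ∑ ws (ι ∘ C c))

  remove : Fin q → (W → Bool) → (Fin q → W → Bool) → Fin q → W → Bool
  remove c Q C c′ w = C c′ w ∧ not ((c Finᶠ.== c′) ∧ Q w)

  mass-remove : ∀ c Q C → mass (remove c Q C) + ∑ ws (λ w → ι (Q w ∧ C c w)) ≤ mass C
  mass-remove c Q C = begin
    mass (remove c Q C) + A
      ≡⟨ cong (mass (remove c Q C) +_) (*-identityˡ A) ⟨
    mass (remove c Q C) + 1 * A
      ≤⟨ +-monoʳ-≤ (mass (remove c Q C)) (*-monoˡ-≤ A (Finᶠ.∑-==-∈ (∈-allFin c))) ⟩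
    mass (remove c Q C) + ∑ (allFin q) (λ c′ → ι (c Finᶠ.== c′)) * A
      ≡⟨ cong (mass (remove c Q C) +_) (∑-*ʳ (allFin q) _ A) ⟨
    mass (remove c Q C) + ∑ (allFin q) (λ c′ → ι (c Finᶠ.== c′) * A)
      ≡⟨ ∑-+ (allFin q) _ _ ⟨
    ∑ (allFin q) (λ c′ → ∑ ws (ι ∘ remove c Q C c′) + ι (c Finᶠ.== c′) * A)
      ≤⟨ ∑-mono (allFin q) perColour ⟩
    mass C ∎
    where
    open ≤-Reasoning
    A = ∑ ws (λ w → ι (Q w ∧ C c w))
    perColour : ∀ c′ → ∑ ws (ι ∘ remove c Q C c′) + ι (c Finᶠ.== c′) * A ≤ ∑ ws (ι ∘ C c′)
    perColour c′ with c Fin.≟ c′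
    ... | no _     = ≤-trans (≤-reflexive (+-identityʳ _)) (∑-mono ws (λ w → ι-mono ∧-elimˡ))
    ... | yes refl = ≤-reflexive (trans (cong (∑ ws _ +_) (*-identityˡ A)) (trans (sym (∑-+ ws _ _)) (∑-cong ws perEdge)))
      where
      perEdge : ∀ w → ι (C c w ∧ not (Q w)) + ι (Q w ∧ C c w) ≡ ι (C c w)
      perEdge w with C c w | Q w
      ... | true  | true  = refl
      ... | true  | false = refl
      ... | false | true  = refl
      ... | false | false = refl

  -- `T` rounds, each with at most `ℓ * J` positive answers and one negative answer.
  depth : ℕ → ℕ
  depth T = T * suc (ℓ * J)

  -- A negative answer puts the queried k-sets out of the container of `c`, and by `query-large`
  -- this lowers `γ * mass C` by at least `D`. The bound `D * suc T` therefore leaves room for `T`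
  -- further rounds.
  build : ∀ T C {K} → Containing C K → γ * mass C < D * suc T → Tree (depth (suc T)) K
  build T C K⊆C light with ramsey C
  ... | inj₁ large = avoids (uncovered C) large covered
    where
    covered : ∀ ω → _ → ∀ c w → In ω c w → uncovered C w ≡ false
    covered ω k c w inw = cong not (anyFin-intro (λ c → C c w) c (K⊆C ω k c w inw))
  ... | inj₂ (f , c , h , big , inside) =
    weaken (≤-reflexive size)
      -- The round starts with `a = 0` and every edge still to be fixed, so nothing has to be known
      -- about the copies in `h` yet.
      (Shrink.level f c C (depth T) (shrunk T light) (allFin ℓ) 0 (Unique.allFin⁺ ℓ)
        (trans (+-identityʳ _) (length-tabulate {n = ℓ} id)) h
        (subst (λ z → ∣X∣ ≤ # h * z) (sym (*-identityʳ (2 * q))) big) caps inside K⊆C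
        (λ ω k x hx i i∉ → ⊥-elim (i∉ (∈-allFin i))))
    where
    size : length (allFin ℓ) * J + suc (depth T) ≡ depth (suc T)
    size = trans (cong (λ z → z * J + suc (depth T)) (length-tabulate {n = ℓ} id)) (+-suc (ℓ * J) (depth T))
    caps : ∀ i → i ∈ allFin ℓ → ∀ w → deg xs (slot f i) h w * μ 0 ≤ 2 * ∣X∣
    caps i _ w = begin
      deg xs (slot f i) h w * (D * 1)            ≡⟨ cong (deg xs (slot f i) h w *_) (*-identityʳ D) ⟩
      deg xs (slot f i) h w * D                  ≤⟨ *-monoˡ-≤ D (∑-mono xs (λ x → ι-mono (∧-elimʳ {h x}))) ⟩
      deg xs (slot f i) (const true) w * D       ≤⟨ degree f i w ⟩
      ∣X∣                                        ≤⟨ m≤m+n ∣X∣ _ ⟩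
      2 * ∣X∣                                    ∎
      where open ≤-Reasoning
    shrunk : ∀ T → γ * mass C < D * suc T → ∀ {K} → Containing C K → ∀ Q → D ≤ γ * ∑ ws (λ w → ι (Q w ∧ C c w)) →
             Tree (depth T) (λ ω → K ω × (∀ w → In ω c w → Q w ≡ false))
    shrunk T light K⊆C Q large = next T lighter
      where
      open ≤-Reasoning
      C′ = remove c Q C
      lighter : D + γ * mass C′ < D + D * T
      lighter = begin-strict
        D + γ * mass C′                                      ≤⟨ +-monoˡ-≤ (γ * mass C′) large ⟩
        γ * ∑ ws (λ w → ι (Q w ∧ C c w)) + γ * mass C′       ≡⟨ *-distribˡ-+ γ _ (mass C′) ⟨
        γ * (∑ ws (λ w → ι (Q w ∧ C c w)) + mass C′)         ≤⟨ *-monoʳ-≤ γ (≤-trans (≤-reflexive (+-comm _ (mass C′))) (mass-remove c Q C)) ⟩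
        γ * mass C                                           <⟨ light ⟩
        D * suc T                                            ≡⟨ *-suc D T ⟩
        D + D * T                                            ∎
      contained : Containing C′ (λ ω → _ × (∀ w → In ω c w → Q w ≡ false))
      contained ω (k , none) c′ w inw with c Fin.≟ c′
      ... | no _     = ∧-introᵇ (K⊆C ω k c′ w inw) refl
      ... | yes refl = ∧-introᵇ (K⊆C ω k c′ w inw) (cong not (none w inw))
      next : ∀ T → D + γ * mass C′ < D + D * T → Tree (depth T) _
      -- With `T = 0` getting stuck is impossible: it would remove `D` from `γ * mass C`, which is
      -- smaller than `D`.
      next zero    l = ⊥-elim (<⇒≱ l (≤-trans (≤-reflexive (trans (cong (D +_) (*-zeroʳ D)) (+-identityʳ D))) (m≤m+n D _)))
      next (suc T) l = build T C′ contained (+-cancelˡ-< D _ _ l)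

  -- Counts the `avoids` leaves of the whole tree whose set is missed by `G`, reached or not. It
  -- thus depends on `G` alone, and one `G` with count zero serves all colourings at once.
  bad : ∀ {L K} → Tree L K → List W → ℕ
  bad (absurd _)       G = 0
  bad (avoids U _ _)   G = ι (all (not ∘ U) G)
  bad (mono _ _ _ _ _) G = 0
  bad (ask _ _ _ t ts) G = bad t G + ∑ ws (λ w → bad (ts w) G)

  module _ (p v : ℕ) where
    open Random p {W}

    -- Union bound: a query has one negative and at most `n` positive branches, so there are at most
    -- `suc n ^ L` leaves, each with failure probability at most `2 ^ -v`.
    𝔼-bad : (∀ U → D ≤ 2 * ∑ ws (ι ∘ U) → 𝔼 ws (λ G → ι (all (not ∘ U) G)) * 2 ^ v ≤ suc p ^ length ws) →
            ∀ {L K} (t : Tree L K) → 𝔼 ws (bad t) * 2 ^ v ≤ suc n ^ L * suc p ^ length ws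
    𝔼-bad leaf (absurd _) = ≤-trans (≤-reflexive (cong (_* 2 ^ v) (𝔼-zero ws (λ _ _ → refl)))) z≤n
    𝔼-bad leaf {L} (avoids U large _) = ≤-trans (leaf U large) (m≤n*m _ (suc n ^ L) {{m^n≢0 (suc n) L}})
    𝔼-bad leaf (mono _ _ _ _ _) = ≤-trans (≤-reflexive (cong (_* 2 ^ v) (𝔼-zero ws (λ _ _ → refl)))) z≤n
    𝔼-bad leaf {L′} (ask {L} L<L′ _ _ t ts) = begin
      𝔼 ws (λ G → bad t G + ∑ ws (λ w → bad (ts w) G)) * V
        ≡⟨ cong (_* V) (trans (𝔼-+ ws _ _) (cong (𝔼 ws (bad t) +_) (𝔼-∑ ws ws _))) ⟩
      (𝔼 ws (bad t) + ∑ ws (λ w → 𝔼 ws (bad (ts w)))) * V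
        ≡⟨ trans (*-distribʳ-+ V (𝔼 ws (bad t)) _) (cong (𝔼 ws (bad t) * V +_) (sym (∑-*ʳ ws _ V))) ⟩
      𝔼 ws (bad t) * V + ∑ ws (λ w → 𝔼 ws (bad (ts w)) * V)
        ≤⟨ +-mono-≤ (𝔼-bad leaf t) (∑-mono ws (λ w → 𝔼-bad leaf (ts w))) ⟩
      B + ∑ ws (λ _ → B)
        ≡⟨ cong (B +_) (∑-const ws B) ⟩
      suc (length ws) * B
        ≤⟨ *-monoˡ-≤ B (s≤s ∣ws∣≤n) ⟩
      suc n * B
        ≡⟨ *-assoc (suc n) (suc n ^ L) _ ⟨
      suc n ^ suc L * suc p ^ length ws
        ≤⟨ *-monoˡ-≤ (suc p ^ length ws) (^-monoʳ-≤ (suc n) L<L′) ⟩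
      suc n ^ L′ * suc p ^ length ws ∎
      where
      open ≤-Reasoning
      V = 2 ^ v
      B = suc n ^ L * suc p ^ length ws

  search : ∀ (G : List W) (χ : W → Fin q) c (Q : W → Bool) →
           (Σ W λ w → In (G , χ) c w × Q w ≡ true) ⊎ (∀ w → In (G , χ) c w → Q w ≡ false)
  search []      χ c Q = inj₂ (λ { w (() , _) })
  search (w ∷ G) χ c Q with search G χ c Q
  ... | inj₁ (u , (u∈ , χu) , Qu) = inj₁ (u , (there u∈ , χu) , Qu)
  ... | inj₂ none with Q w in eq | χ w Fin.≟ c
  ...   | true  | yes χw = inj₁ (w , (here refl , χw) , eq)
  ...   | true  | no χw≢ = inj₂ (λ { u (here refl , χu) → ⊥-elim (χw≢ χu) ; u (there u∈ , χu) → none u (u∈ , χu) })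
  ...   | false | _      = inj₂ (λ { u (here refl , χu) → eq ; u (there u∈ , χu) → none u (u∈ , χu) })

  -- Following the true answers of `(G , χ)` preserves the knowledge `K`. At an `avoids` leaf this
  -- knowledge says that `G` misses `U`, which `bad t G ≡ 0` excludes, so the walk ends at a `mono`
  -- leaf.
  walk : ∀ G χ → (∀ {w} → w ∈ G → w ∈ ws) → ∀ {L K} (t : Tree L K) → K (G , χ) → bad t G ≡ 0 →
         Σ (X → 𝔽) λ f → Σ (Fin q) λ c → Σ (X → Bool) λ h → ∣X∣ ≤ # h * β ℓ ×
           (∀ x → h x ≡ true → ∀ i → In (G , χ) c (slot f i x))
  walk G χ G⊆ (absurd no-ω) k _ = ⊥-elim (no-ω (G , χ) k)
  walk G χ G⊆ (avoids U _ avoid) k b with trans (sym b) (cong ι (avoided G id))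
    where
    avoided : ∀ H → (∀ {w} → w ∈ H → w ∈ G) → all (not ∘ U) H ≡ true
    avoided []      H⊆ = refl
    avoided (w ∷ H) H⊆ = ∧-introᵇ (cong not (avoid (G , χ) k (χ w) w (H⊆ (here refl) , refl))) (avoided H (H⊆ ∘ there))
  ... | ()
  walk G χ G⊆ (mono f c h big known) k _ = f , c , h , big , known (G , χ) k
  walk G χ G⊆ (ask _ c Q t ts) k b with search G χ c Q
  ... | inj₂ none            = walk G χ G⊆ t (k , none) (m+n≡0⇒m≡0 (bad t G) b)
  ... | inj₁ (w , inw , Qw)  = walk G χ G⊆ (ts w) (k , inw , Qw)
          (n≤0⇒n≡0 (≤-trans (∑-∈ (λ w → bad (ts w) G) (G⊆ (proj₁ inw))) (≤-reflexive (m+n≡0⇒n≡0 (bad t G) b))))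

-- Copies inside the grid

-- Bernoulli's inequality `1 + m / p ≤ (1 + 1 / p) ^ m` without denominators.
bernoulli : ∀ p m → p ^ m * (p + m) ≤ p * suc p ^ m
bernoulli p zero    = ≤-reflexive (trans (*-identityˡ (p + 0)) (trans (+-identityʳ p) (sym (*-identityʳ p))))
bernoulli p (suc m) = begin
  p * p ^ m * (p + suc m)          ≤⟨ m≤m+n _ (p ^ m * m) ⟩
  p * p ^ m * (p + suc m) + p ^ m * m ≡⟨ rearrange p (p ^ m) m ⟩
  suc p * (p ^ m * (p + m))        ≤⟨ *-monoʳ-≤ (suc p) (bernoulli p m) ⟩
  suc p * (p * suc p ^ m)          ≡⟨ swap (suc p) p (suc p ^ m) ⟩
  p * (suc p * suc p ^ m)          ∎
  where
  open ≤-Reasoning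
  rearrange : ∀ p z m → p * z * (p + suc m) + z * m ≡ suc p * (z * (p + m))
  rearrange = solve-∀
  swap : ∀ a b c → a * (b * c) ≡ b * (a * c)
  swap = solve-∀

2p^P≤P^P : ∀ p → p ^ suc p * 2 ≤ suc p ^ suc p
2p^P≤P^P zero      = z≤n
2p^P≤P^P p@(suc _) = *-cancelˡ-≤ p (begin
  p * (p ^ suc p * 2)      ≡⟨ swap p (p ^ suc p) ⟩
  p ^ suc p * (p + p)      ≤⟨ *-monoʳ-≤ (p ^ suc p) (+-monoʳ-≤ p (n≤1+n p)) ⟩
  p ^ suc p * (p + suc p)  ≤⟨ bernoulli p (suc p) ⟩
  p * suc p ^ suc p        ∎)
  where
  open ≤-Reasoning
  swap : ∀ a b → a * (b * 2) ≡ b * (a + a)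
  swap = solve-∀

-- Since `(1 - 1 / P) ^ P ≤ 1 / 2`, each block of `P` of the `u` factors yields a factor `1 / 2`,
-- and there are at least `v` blocks.
p^u*2^v≤P^u : ∀ p v u → suc p * v ≤ u → p ^ u * 2 ^ v ≤ suc p ^ u
p^u*2^v≤P^u p v u Pv≤u = begin
  p ^ u * 2 ^ v                                     ≡⟨ cong (λ z → p ^ z * 2 ^ v) (m+[n∸m]≡n Pv≤u) ⟨
  p ^ (suc p * v + w) * 2 ^ v                       ≡⟨ cong (_* 2 ^ v) (trans (^-distribˡ-+-* p (suc p * v) w) (cong (_* p ^ w) (sym (^-*-assoc p (suc p) v)))) ⟩
  (p ^ suc p) ^ v * p ^ w * 2 ^ v                   ≡⟨ swap ((p ^ suc p) ^ v) (p ^ w) (2 ^ v) ⟩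
  (p ^ suc p) ^ v * 2 ^ v * p ^ w                   ≡⟨ cong (_* p ^ w) (^-distribʳ-* v (p ^ suc p) 2) ⟨
  (p ^ suc p * 2) ^ v * p ^ w                       ≤⟨ *-mono-≤ (^-monoˡ-≤ v (2p^P≤P^P p)) (^-monoˡ-≤ w (n≤1+n p)) ⟩
  (suc p ^ suc p) ^ v * suc p ^ w                   ≡⟨ trans (cong (_* suc p ^ w) (^-*-assoc (suc p) (suc p) v)) (sym (^-distribˡ-+-* (suc p) (suc p * v) w)) ⟩
  suc p ^ (suc p * v + w)                           ≡⟨ cong (suc p ^_) (m+[n∸m]≡n Pv≤u) ⟩
  suc p ^ u                                         ∎
  where
  open ≤-Reasoning
  w = u ∸ suc p * v
  swap : ∀ a b c → a * b * c ≡ a * c * b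
  swap = solve-∀

all-false : ∀ {A : Set} (p : A → Bool) l → all p l ≡ false → ∃ λ a → p a ≡ false
all-false p (a ∷ l) h with p a in eq
... | false = a , eq
... | true  = all-false p l h

anyFin-none : ∀ {t} (f : Fin t → Bool) → ¬ (∃ λ i → f i ≡ true) → anyFin f ≡ false
anyFin-none f none with anyFin f in eq
... | false = refl
... | true  = ⊥-elim (none (anyFin-elim f eq))

unique-⊆ : ∀ {A : Set} {l m : List A} → l ⊆ m → Unique m → Unique l
unique-⊆ Sublist.[]          u        = []
unique-⊆ (_ Sublist.∷ʳ l⊆)   (_ ∷ u)  = unique-⊆ l⊆ u
unique-⊆ (refl Sublist.∷ l⊆) (a≢ ∷ u) = All-resp-⊆ l⊆ a≢ ∷ unique-⊆ l⊆ u

module Copies {k t q R : ℕ} (F : Hypergraph k t) (M : ℕ) where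

  open Fibres (_≟ˢ_ {R * M})

  ℓ N : ℕ
  ℓ = numEdges F
  N = R * M

  -- Injectivity is part of the datum because `degree` and `codegree` must hold for every assignment
  -- of embeddings to transversals, and both need the slots to have size `k`.
  Embedding : Set
  Embedding = Σ (Fin t → Fin R) (Injective _≡_ _≡_)

  edge : Fin ℓ → Subset t
  edge = List.lookup (edges F)

  edge∈ : ∀ i → edge i ∈ edges F
  edge∈ i = ∈-lookup i

  copy : (Fin t → Fin R) → Vec (Fin M) R → Subset t → Subset N
  copy φ x = image (point x ∘ φ)

  copy-injective : ∀ {φ : Fin t → Fin R} → Injective _≡_ _≡_ φ → (x : Vec (Fin M) R) → Injective _≡_ _≡_ (point x ∘ φ)
  copy-injective inj x = inj ∘ point-injective x

  slot : (Vec (Fin M) R → Embedding) → Fin ℓ → Vec (Fin M) R → Subset N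
  slot f i x = copy (proj₁ (f x)) x (edge i)

  ∣slot∣ : ∀ f i x → ∣ slot f i x ∣ ≡ k
  ∣slot∣ f i x = trans (∣image∣ (point x ∘ proj₁ (f x)) (copy-injective (proj₂ (f x)) x) (edge i))
                       (All.lookup (uniform F) (edge∈ i))

  slot⊑graph : ∀ f i x → (slot f i x ⊑ graph x) ≡ true
  slot⊑graph f i x = image-⊑-graph x (proj₁ (f x)) (edge i)

  unique-lookup : ∀ {A : Set} {l : List A} → Unique l → ∀ i j → List.lookup l i ≡ List.lookup l j → i ≡ j
  unique-lookup (a≢ ∷ u) Fin.zero    Fin.zero    e = refl
  unique-lookup (a≢ ∷ u) Fin.zero    (Fin.suc j) e = ⊥-elim (All.lookup a≢ (∈-lookup j) e)
  unique-lookup (a≢ ∷ u) (Fin.suc i) Fin.zero    e = ⊥-elim (All.lookup a≢ (∈-lookup i) (sym e))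
  unique-lookup (a≢ ∷ u) (Fin.suc i) (Fin.suc j) e = cong Fin.suc (unique-lookup u i j e)

  xs : List (Vec (Fin M) R)
  xs = vecs M R

  ws : List (Subset N)
  ws = kSubsets N k

  zero-count : ∀ {A : Set} (l : List A) {b : A → Bool} m {n} → (∀ a → ¬ (b a ≡ true)) → ∑ l (ι ∘ b) * m ≤ n
  zero-count l {b} m h = ≤-trans (≤-reflexive (cong (_* m) (trans (∑-cong l none) (trans (∑-const l 0) (*-zeroʳ (length l)))))) z≤n
    where
    none : ∀ a → ι (b a) ≡ 0
    none a with b a in eq
    ... | true  = ⊥-elim (h a eq)
    ... | false = refl

  degree : ∀ f i w → deg xs (slot f i) (const true) w * M ^ k ≤ length xs
  degree f i w with ∣ w ∣ ℕ.≟ k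
  ... | no ∣w∣≢k = zero-count xs (M ^ k) (λ x h → ∣w∣≢k (trans (cong ∣_∣ (sym (==⇒≡ h))) (∣slot∣ f i x)))
  ... | yes refl = begin
    deg xs (slot f i) (const true) w * M ^ ∣ w ∣     ≤⟨ *-monoˡ-≤ (M ^ ∣ w ∣) (∑-mono xs (λ x → ι-mono (λ h → subst (λ z → (z ⊑ graph x) ≡ true) (==⇒≡ h) (slot⊑graph f i x)))) ⟩
    ∑ xs (λ x → ι (w ⊑ graph x)) * M ^ ∣ w ∣         ≤⟨ count-transversals R w ⟩
    M ^ R                                            ≡⟨ length-vecs M R ⟨
    length xs                                        ∎
    where open ≤-Reasoning

  -- Distinct edges have distinct images, so a transversal is counted only if `w ∪ v` has at least k
  -- + 1 points, and then it contains all of them.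
  codegree : 1 ≤ M → ∀ f i j → i ≢ j → ∀ w v →
             ∑ xs (λ x → ι ((slot f i x == w) ∧ (slot f j x == v))) * (M ^ k * M) ≤ length xs
  codegree M≥1 f i j i≢j w v with suc k ≤? ∣ w ∪ v ∣
  ... | no small = zero-count xs (M ^ k * M) impossible
    where
    impossible : ∀ x → ¬ ((slot f i x == w) ∧ (slot f j x == v) ≡ true)
    impossible x h with ==⇒≡ {slot f i x} {w} (∧-elimˡ h) | ==⇒≡ {slot f j x} {v} (∧-elimʳ {slot f i x == w} h)
    ... | refl | refl = small (subst (_< ∣ slot f i x ∪ slot f j x ∣) (∣slot∣ f i x)
      (∣∪∣-distinct (slot f i x) (slot f j x)
        (λ e → i≢j (unique-lookup (unique F) i j (image-injective (copy-injective (proj₂ (f x)) x) e)))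
        (trans (∣slot∣ f i x) (sym (∣slot∣ f j x)))))
  ... | yes large = begin
    both * (M ^ k * M)                               ≡⟨ cong (both *_) (*-comm (M ^ k) M) ⟩
    both * M ^ suc k                                 ≤⟨ *-mono-≤ (∑-mono xs (λ x → ι-mono (inside x))) (^-monoʳ-≤ M {{>-nonZero M≥1}} large) ⟩
    ∑ xs (λ x → ι (w ∪ v ⊑ graph x)) * M ^ ∣ w ∪ v ∣ ≤⟨ count-transversals R (w ∪ v) ⟩
    M ^ R                                            ≡⟨ length-vecs M R ⟨
    length xs                                        ∎
    where
    open ≤-Reasoning
    both = ∑ xs (λ x → ι ((slot f i x == w) ∧ (slot f j x == v)))
    inside : ∀ x → (slot f i x == w) ∧ (slot f j x == v) ≡ true → (w ∪ v ⊑ graph x) ≡ true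
    inside x h = ⊑-∪ w v (graph x)
      (subst (λ z → (z ⊑ graph x) ≡ true) (==⇒≡ {slot f i x} {w} (∧-elimˡ h)) (slot⊑graph f i x))
      (subst (λ z → (z ⊑ graph x) ≡ true) (==⇒≡ {slot f j x} {v} (∧-elimʳ {slot f i x == w} h)) (slot⊑graph f j x))

  -- The Ramsey dichotomy for containers

  module Ramsey (arrows : CompleteArrows R F q) (c₀ : Fin q) (M≥1 : 1 ≤ M) (C : Fin q → Subset N → Bool) where

    covered : Subset N → Bool
    covered w = anyFin (λ c → C c w)

    -- The auxiliary colouring: a k-set gets the colour of some container covering it, with `c₀` as
    -- default for uncovered sets.
    pick : Subset N → Fin q
    pick w with Fin.any? (λ c → C c w Bool.≟ true)
    ... | yes (c , _) = c
    ... | no _        = c₀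

    pick-covers : ∀ w → C (pick w) w ≡ false → not (covered w) ≡ true
    pick-covers w h with Fin.any? (λ c → C c w Bool.≟ true)
    ... | yes (c , h′) with trans (sym h) h′
    ...   | ()
    pick-covers w h | no none = cong not (anyFin-none (λ c → C c w) none)

    found : ∀ x → Σ (Fin t → Fin R) λ φ → Injective _≡_ _≡_ φ × Monochromatic F (pick ∘ image (point x)) φ
    found x = arrows (pick ∘ image (point x))

    emb : Vec (Fin M) R → Embedding
    emb x = proj₁ (found x) , proj₁ (proj₂ (found x))

    colour : Vec (Fin M) R → Fin q
    colour x = proj₁ (proj₂ (proj₂ (found x)))

    good : Vec (Fin M) R → Bool
    good x = all (λ i → C (colour x) (slot emb i x)) (allFin ℓ)

    -- All edges of the chosen copy are picked with the colour of `x`. If one of them is outside the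
    -- container of that colour, `pick` must have used its default.
    bad⇒uncovered : ∀ x → good x ≡ false → ∃ λ i → not (covered (slot emb i x)) ≡ true
    bad⇒uncovered x h with all-false _ (allFin ℓ) h
    ... | i , h′ = i , pick-covers (slot emb i x) (subst (λ c → C c (slot emb i x) ≡ false) (sym eq) h′)
      where
      eq : pick (slot emb i x) ≡ colour x
      eq = trans (cong pick (sym (image-∘ (point x) (proj₁ (found x)) (edge i))))
                 (All.lookup (proj₂ (proj₂ (proj₂ (found x)))) (edge∈ i))

    u : ℕ
    u = ∑ ws (ι ∘ not ∘ covered)

    -- Double counting: a transversal that is not good contains an uncovered k-set, and each k-set
    -- lies in at most a `1 / M ^ k` share of the transversals.
    few-bad : ∑ xs (λ x → ι (not (good x))) * M ^ k ≤ u * length xs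
    few-bad = begin
      ∑ xs (λ x → ι (not (good x))) * M ^ k
        ≤⟨ *-monoˡ-≤ (M ^ k) (∑-mono xs pointwise) ⟩
      ∑ xs (λ x → ∑ ws (λ w → ι (not (covered w)) * ι (w ⊑ graph x))) * M ^ k
        ≡⟨ cong (_* M ^ k) (trans (∑-swap xs ws _) (∑-cong ws (λ w → ∑-*ˡ xs _ (ι (not (covered w)))))) ⟩
      ∑ ws (λ w → ι (not (covered w)) * ∑ xs (λ x → ι (w ⊑ graph x))) * M ^ k
        ≡⟨ ∑-*ʳ ws _ (M ^ k) ⟨
      ∑ ws (λ w → ι (not (covered w)) * ∑ xs (λ x → ι (w ⊑ graph x)) * M ^ k)
        ≤⟨ ∑-mono-∈ ws perEdge ⟩
      ∑ ws (λ w → ι (not (covered w)) * length xs)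
        ≡⟨ ∑-*ʳ ws _ (length xs) ⟩
      u * length xs ∎
      where
      open ≤-Reasoning
      perEdge : ∀ w → w ∈ ws → ι (not (covered w)) * ∑ xs (λ x → ι (w ⊑ graph x)) * M ^ k ≤ ι (not (covered w)) * length xs
      perEdge w w∈ = begin
        ι (not (covered w)) * ∑ xs (λ x → ι (w ⊑ graph x)) * M ^ k        ≡⟨ *-assoc (ι (not (covered w))) _ _ ⟩
        ι (not (covered w)) * (∑ xs (λ x → ι (w ⊑ graph x)) * M ^ k)      ≡⟨ cong (λ z → ι (not (covered w)) * (∑ xs (λ x → ι (w ⊑ graph x)) * M ^ z)) (kSubsets-size N k w∈) ⟨
        ι (not (covered w)) * (∑ xs (λ x → ι (w ⊑ graph x)) * M ^ ∣ w ∣)  ≤⟨ *-monoʳ-≤ (ι (not (covered w))) (≤-trans (count-transversals R w) (≤-reflexive (sym (length-vecs M R)))) ⟩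
        ι (not (covered w)) * length xs                                   ∎
      pointwise : ∀ x → ι (not (good x)) ≤ ∑ ws (λ w → ι (not (covered w)) * ι (w ⊑ graph x))
      pointwise x with good x in eq
      ... | true  = z≤n
      ... | false with bad⇒uncovered x eq
      ...   | i , h = ≤-trans (≤-reflexive (sym (cong₂ (λ a b → ι a * ι b) h (slot⊑graph emb i x))))
                       (∑-∈ (λ w → ι (not (covered w)) * ι (w ⊑ graph x)) (∈-kSubsets _ (∣slot∣ emb i x)))

    class : Fin q → Vec (Fin M) R → Bool
    class c x = good x ∧ ⌊ colour x Fin.≟ c ⌋

    class-inside : ∀ c x → class c x ≡ true → ∀ i → C c (slot emb i x) ≡ true
    class-inside c x h i with colour x Fin.≟ c
    ... | yes eq = subst (λ c → C c (slot emb i x) ≡ true) eq (all-elim _ (∧-elimˡ h) (∈-allFin i))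
    ... | no _   with ∧-elimʳ {good x} h
    ...   | ()

    -- With fewer than `M ^ k / 2` uncovered sets, `few-bad` leaves at least half of the
    -- transversals good; some colour receives a `1 / q` share of these.
    large-class : ¬ (M ^ k ≤ 2 * u) → Σ (Fin q) λ c → length xs ≤ ∑ xs (ι ∘ class c) * (2 * q)
    large-class ¬large = proj₁ found-class , ≤-pred (proj₂ (proj₂ found-class))
      where
      open ≤-Reasoning
      gs bs : ℕ
      gs = ∑ xs (ι ∘ good)
      bs = ∑ xs (λ x → ι (not (good x)))
      gs+bs : gs + bs ≡ length xs
      gs+bs = trans (sym (∑-+ xs _ _)) (trans (∑-cong xs (λ x → complement (good x))) (trans (∑-const xs 1) (*-identityʳ _)))
        where
        complement : ∀ b → ι b + ι (not b) ≡ 1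
        complement true  = refl
        complement false = refl
      2bs≤ : 2 * bs ≤ length xs
      2bs≤ = *-cancelʳ-≤ (2 * bs) (length xs) (M ^ k) {{m^n≢0 M k {{>-nonZero M≥1}}}} (begin
        2 * bs * M ^ k            ≡⟨ *-assoc 2 bs (M ^ k) ⟩
        2 * (bs * M ^ k)          ≤⟨ *-monoʳ-≤ 2 few-bad ⟩
        2 * (u * length xs)       ≡⟨ *-assoc 2 u (length xs) ⟨
        2 * u * length xs         ≤⟨ *-monoˡ-≤ (length xs) (<⇒≤ (≰⇒> ¬large)) ⟩
        M ^ k * length xs         ≡⟨ *-comm (M ^ k) (length xs) ⟩
        length xs * M ^ k         ∎)
      half : length xs ≤ 2 * gs
      half = +-cancelʳ-≤ (2 * bs) (length xs) (2 * gs) (begin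
        length xs + 2 * bs        ≤⟨ +-monoʳ-≤ (length xs) 2bs≤ ⟩
        length xs + length xs     ≡⟨ cong₂ _+_ (sym gs+bs) (sym gs+bs) ⟩
        (gs + bs) + (gs + bs)     ≡⟨ rearrange gs bs ⟩
        2 * gs + 2 * bs           ∎)
        where
        rearrange : ∀ a b → (a + b) + (a + b) ≡ 2 * a + 2 * b
        rearrange = solve-∀
      gs≤ : gs ≤ ∑ (allFin q) (λ c → ∑ xs (ι ∘ class c))
      gs≤ = ≤-trans (≤-trans (∑-mono xs (λ x → ι-mono (λ h → ∧-introᵇ h refl)))
                             (Fibres.fibre-≤ Fin._≟_ xs colour (allFin q) good (const true) (λ x → ∈-allFin (colour x))))
                    (≤-reflexive (∑-cong (allFin q) (λ c → *-identityˡ _)))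
      -- The `suc` makes the averaging inequality strict, as `∑-find` demands; `≤-pred` takes it off
      -- again.
      some-large : ∑ (allFin q) (λ _ → length xs) < ∑ (allFin q) (λ c → suc (∑ xs (ι ∘ class c) * (2 * q)))
      some-large = begin-strict
        ∑ (allFin q) (λ _ → length xs)    ≡⟨ trans (∑-const (allFin q) _) (cong (_* length xs) (length-tabulate {n = q} id)) ⟩
        q * length xs                     ≤⟨ *-monoʳ-≤ q half ⟩
        q * (2 * gs)                      ≡⟨ rearrange q gs ⟩
        gs * (2 * q)                      <⟨ m<n+m (gs * (2 * q)) (≤-trans (s≤s z≤n) (Fin.toℕ<n c₀)) ⟩
        q + gs * (2 * q)                  ≤⟨ +-monoʳ-≤ q (*-monoˡ-≤ (2 * q) gs≤) ⟩
        q + ∑ (allFin q) (λ c → ∑ xs (ι ∘ class c)) * (2 * q)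
          ≡⟨ cong₂ _+_ (sym (trans (∑-const (allFin q) 1) (trans (*-identityʳ _) (length-tabulate {n = q} id)))) (sym (∑-*ʳ (allFin q) _ (2 * q))) ⟩
        ∑ (allFin q) (λ _ → 1) + ∑ (allFin q) (λ c → ∑ xs (ι ∘ class c) * (2 * q))
          ≡⟨ ∑-+ (allFin q) _ _ ⟨
        ∑ (allFin q) (λ c → suc (∑ xs (ι ∘ class c) * (2 * q))) ∎
        where
        rearrange : ∀ q g → q * (2 * g) ≡ g * (2 * q)
        rearrange = solve-∀
      found-class = ∑-find (allFin q) (λ _ → length xs) (λ c → suc (∑ xs (ι ∘ class c) * (2 * q))) some-large

    Dichotomy : Set
    Dichotomy = M ^ k ≤ 2 * u ⊎
      (Σ (Vec (Fin M) R → Embedding) λ f → Σ (Fin q) λ c → Σ (Vec (Fin M) R → Bool) λ h →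
        length xs ≤ ∑ xs (ι ∘ h) * (2 * q) × (∀ x → h x ≡ true → ∀ i → C c (slot f i x) ≡ true))

    dichotomy : Dichotomy
    dichotomy = decide (M ^ k ≤? 2 * u)
      where
      class-found : (Σ (Fin q) λ c → length xs ≤ ∑ xs (ι ∘ class c) * (2 * q)) → Dichotomy
      class-found (c , large) = inj₂ (emb , c , class c , large , class-inside c)
      decide : Dec (M ^ k ≤ 2 * u) → Dichotomy
      decide (yes large) = inj₁ large
      decide (no ¬large) = class-found (large-class ¬large)

  -- Choosing the hypergraph by a first-moment argument

  module Random-hypergraph
    (arrows : CompleteArrows R F q) (c₀ : Fin q) (s J T p v : ℕ)
    (R≥1 : 1 ≤ R) (M≥1 : 1 ≤ M) (ℓ≥1 : 1 ≤ ℓ) (s≥1 : 1 ≤ s)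
    (s^ℓ≤M : s ^ ℓ ≤ M) (4n≤Jr : 4 * N ^ k ≤ J * (6 * ℓ * s)) where

    q≥1 : 1 ≤ q
    q≥1 = ≤-trans (s≤s z≤n) (Fin.toℕ<n c₀)

    setting : Setting
    setting = record
      { _≟_ = _≟ˢ_ ; xs = xs ; ws = ws ; ws-unique = kSubsets-unique N k
      ; q = q ; ℓ = ℓ ; s = s ; M = M ; D = M ^ k ; n = N ^ k ; J = J
      ; slot = slot
      ; q≥1 = q≥1 ; ℓ≥1 = ℓ≥1 ; s≥1 = s≥1
      ; D≥1 = m^n>0 M {{>-nonZero M≥1}} k
      ; n≥1 = m^n>0 N {{>-nonZero (*-mono-≤ R≥1 M≥1)}} k
      ; ∣X∣≥1 = ≤-trans (m^n>0 M {{>-nonZero M≥1}} R) (≤-reflexive (sym (length-vecs M R)))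
      ; s^ℓ≤M = s^ℓ≤M
      ; ∣ws∣≤n = length-kSubsets N k
      ; 4n≤Jr = 4n≤Jr
      ; slot∈ = λ f i x → ∈-kSubsets (slot f i x) (∣slot∣ f i x)
      ; degree = degree
      ; codegree = codegree M≥1
      ; ramsey = Ramsey.dichotomy arrows c₀ M≥1
      }

    open Containers setting
    open Random p {Subset N}

    P ∣X∣ ∣W∣ : ℕ
    P = suc p
    ∣X∣ = length xs
    ∣W∣ = length ws

    marked : (Fin t → Fin R) → Vec (Fin M) R → Subset t → List (Subset N)
    marked φ x S = map (copy φ x) (S ∷ edges F)

    count : List (Subset N) → List (Subset N) → ℕ
    count ds G = ∑ G (λ w → ι (w ∈ᵇ ds))

    -- The guard on ws makes the term vanish unless the ℓ + 1 marked sets are distinct.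
    noninduced : Vec (Fin M) R → (Fin t → Fin R) → Subset t → List (Subset N) → ℕ
    noninduced x φ S G = ι (suc ℓ ≤ᵇ count (marked φ x S) ws) * ι (count (marked φ x S) ws ≤ᵇ count (marked φ x S) G)

    -- Sums over all maps `Fin t → Fin R`, because the embeddings found later depend on the
    -- colouring while `G` has to be fixed before it.
    total-noninduced-at : Vec (Fin M) R → List (Subset N) → ℕ
    total-noninduced-at x G = ∑ (vecs R t) (λ y → ∑ (kSubsets t k) (λ S → noninduced x (lookup y) S G))

    total-noninduced : List (Subset N) → ℕ
    total-noninduced G = ∑ xs (λ x → total-noninduced-at x G)

    -- A term that passes the guard requires at least `suc ℓ` distinct k-sets to be kept, each with
    -- probability `1 / P`.
    𝔼-noninduced : ∀ x φ S → 𝔼 ws (noninduced x φ S) * P ^ suc ℓ ≤ P ^ ∣W∣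
    𝔼-noninduced x φ S with suc ℓ ≤ᵇ count (marked φ x S) ws in eq
    ... | false = ≤-trans (≤-reflexive (cong (_* P ^ suc ℓ) (𝔼-zero ws (λ _ _ → refl)))) z≤n
    ... | true  = begin
      𝔼 ws (λ G → 1 * ι (count ds ws ≤ᵇ count ds G)) * P ^ suc ℓ
        ≤⟨ *-mono-≤ (𝔼-mono ws (λ G _ → ≤-reflexive (*-identityˡ _))) (^-monoʳ-≤ P (≤ᵇ-true (suc ℓ) (count ds ws) eq)) ⟩
      𝔼 ws (λ G → ι (count ds ws ≤ᵇ count ds G)) * P ^ count ds ws
        ≤⟨ 𝔼-contain ws (λ w → w ∈ᵇ ds) ⟩
      P ^ ∣W∣ ∎
      where
      open ≤-Reasoning
      ds = marked φ x S

    𝔼-total-noninduced : 𝔼 ws total-noninduced * P ^ suc ℓ ≤ ∣X∣ * (R ^ t * t ^ k) * P ^ ∣W∣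
    𝔼-total-noninduced = begin
      𝔼 ws total-noninduced * P ^ suc ℓ
        ≡⟨ cong (_* P ^ suc ℓ) (trans (𝔼-∑ ws xs _) (∑-cong xs (λ x → trans (𝔼-∑ ws (vecs R t) _) (∑-cong (vecs R t) (λ y → 𝔼-∑ ws (kSubsets t k) _))))) ⟩
      ∑ xs (λ x → ∑ (vecs R t) (λ y → ∑ (kSubsets t k) (λ S → 𝔼 ws (noninduced x (lookup y) S)))) * P ^ suc ℓ
        ≡⟨ trans (sym (∑-*ʳ xs _ _)) (∑-cong xs (λ x → trans (sym (∑-*ʳ (vecs R t) _ _)) (∑-cong (vecs R t) (λ y → sym (∑-*ʳ (kSubsets t k) _ _))))) ⟩
      ∑ xs (λ x → ∑ (vecs R t) (λ y → ∑ (kSubsets t k) (λ S → 𝔼 ws (noninduced x (lookup y) S) * P ^ suc ℓ)))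
        ≤⟨ ∑-mono xs (λ x → ∑-mono (vecs R t) (λ y → ∑-mono (kSubsets t k) (λ S → 𝔼-noninduced x (lookup y) S))) ⟩
      ∑ xs (λ x → ∑ (vecs R t) (λ y → ∑ (kSubsets t k) (λ S → P ^ ∣W∣)))
        ≡⟨ trans (∑-const xs _) (cong (∣X∣ *_) (trans (∑-const (vecs R t) _) (cong₂ _*_ (length-vecs R t) (∑-const (kSubsets t k) _)))) ⟩
      ∣X∣ * (R ^ t * (length (kSubsets t k) * P ^ ∣W∣))
        ≤⟨ *-monoʳ-≤ ∣X∣ (*-monoʳ-≤ (R ^ t) (*-monoˡ-≤ (P ^ ∣W∣) (length-kSubsets t k))) ⟩
      ∣X∣ * (R ^ t * (t ^ k * P ^ ∣W∣))
        ≡⟨ rearrange ∣X∣ (R ^ t) (t ^ k) (P ^ ∣W∣) ⟩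
      ∣X∣ * (R ^ t * t ^ k) * P ^ ∣W∣ ∎
      where
      open ≤-Reasoning
      rearrange : ∀ a b c d → a * (b * (c * d)) ≡ a * (b * c) * d
      rearrange = solve-∀

    toHypergraph : ∀ {G} → G ⊆ ws → Hypergraph k N
    toHypergraph {G} G⊆ws = record
      { edges   = G
      ; unique  = unique-⊆ G⊆ws (kSubsets-unique N k)
      ; uniform = All-resp-⊆ G⊆ws (All.tabulate (kSubsets-size N k))
      }

    module Found (G : List (Subset N)) (G⊆ws : G ⊆ ws) (few-noninduced : total-noninduced G * β ℓ < ∣X∣)
      (χ : Colouring N q) (f : Vec (Fin M) R → Embedding) (c : Fin q) (h : Vec (Fin M) R → Bool)
      (big : ∣X∣ ≤ ∑ xs (ι ∘ h) * β ℓ)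
      (known : ∀ x → h x ≡ true → ∀ i → slot f i x ∈ G × χ (slot f i x) ≡ c) where

      chosen : Σ (Vec (Fin M) R) λ x → x ∈ xs × total-noninduced-at x G < ι (h x)
      -- `few-noninduced` and `big` make the number of non-induced patterns smaller than `# h`.
      -- Where it is below `ι (h x)`, the copy belongs to `h` and the number is zero.
      chosen = ∑-find xs _ _ (*-cancelʳ-< (β ℓ) _ _ (<-≤-trans few-noninduced big))
      x = proj₁ chosen
      φ = proj₁ (f x)
      inj : Injective _≡_ _≡_ (point x ∘ φ)
      inj = copy-injective (proj₂ (f x)) x
      hx : h x ≡ true
      hx = positive (h x) (proj₂ (proj₂ chosen))
        where
        positive : ∀ b {m} → m < ι b → b ≡ true
        positive true _ = refl
      none : total-noninduced-at x G ≡ 0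
      none = n<1⇒n≡0 (<-≤-trans (proj₂ (proj₂ chosen)) (ι≤1 (h x)))
      edge-index : ∀ {e} → e ∈ edges F → Σ (Fin ℓ) λ i → e ≡ edge i
      edge-index e∈ = index e∈ , Any.lookup-index e∈
      in-G : ∀ {e} → e ∈ edges F → copy φ x e ∈ G
      in-G e∈ with edge-index e∈
      ... | i , refl = proj₁ (known x hx i)
      coloured : ∀ {e} → e ∈ edges F → χ (copy φ x e) ≡ c
      coloured e∈ with edge-index e∈
      ... | i , refl = proj₂ (known x hx i)
      induced : ∀ S → ∣ S ∣ ≡ k → copy φ x S ∈ G → S ∈ edges F
      induced S ∣S∣≡k S∈G = decide (S ∈ᵇᵗ edges F) refl
        where
        open Fibres (_≟ˢ_ {t}) using () renaming (_∈ᵇ_ to _∈ᵇᵗ_; ∈ᵇ⇒∈ to ∈ᵇᵗ⇒∈; ∈⇒∈ᵇ to ∈⇒∈ᵇᵗ)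
        y : Vec (Fin R) t
        y = tabulate φ
        same : ∀ S′ → copy (lookup y) x S′ ≡ copy φ x S′
        same = image-cong (λ i → cong (point x) (lookup∘tabulate φ i))
        ds = marked (lookup y) x S
        ds⊆G : All (_∈ G) ds
        ds⊆G = subst (_∈ G) (sym (same S)) S∈G ∷
               All.map⁺ (All.tabulate (λ {e} e∈ → subst (_∈ G) (sym (same e)) (in-G e∈)))
        ∣ds∣ : length ds ≡ suc ℓ
        ∣ds∣ = cong suc (length-map (copy (lookup y) x) (edges F))
        decide : ∀ b → (S ∈ᵇᵗ edges F) ≡ b → S ∈ edges F
        decide true  eq = ∈ᵇᵗ⇒∈ (edges F) eq
        -- If `S` were a non-edge, its image and those of the edges would be `suc ℓ` distinct
        -- members of `G`, contributing 1 to a sum that is zero at `x`.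
        decide false eq = ⊥-elim (<-irrefl (sym none) (≤-trans (≤-reflexive (sym counted))
          (≤-trans (∑-∈ (λ S → noninduced x (lookup y) S G) (∈-kSubsets S ∣S∣≡k))
                   (∑-∈ (λ y → ∑ (kSubsets t k) (λ S → noninduced x (lookup y) S G)) (∈-vecs y)))))
          where
          S∉F : S ∉ edges F
          S∉F S∈ with trans (sym eq) (∈⇒∈ᵇᵗ S∈)
          ... | ()
          ds-unique : Unique ds
          ds-unique = Unique.map⁺ (λ {a} {b} e → image-injective inj (trans (sym (same a)) (trans e (same b))))
                        (All.tabulate (λ { e∈ refl → S∉F e∈ }) ∷ unique F)
          large : suc ℓ ≤ count ds ws
          large = ≤-trans (≤-reflexive (sym ∣ds∣)) (count-∈ᵇ-≥ ds-unique (All.map (Sublist.lookup G⊆ws) ds⊆G))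
          complete : count ds ws ≤ count ds G
          complete = ≤-trans (count-∈ᵇ-≤ ds (kSubsets-unique N k)) (count-∈ᵇ-≥ ds-unique ds⊆G)
          ≤ᵇ-intro : ∀ {m n} → m ≤ n → (m ≤ᵇ n) ≡ true
          ≤ᵇ-intro {m} {n} m≤n with m ≤ᵇ n in e
          ... | true  = refl
          ... | false = ⊥-elim (<⇒≱ (≤ᵇ-false m n e) m≤n)
          counted : noninduced x (lookup y) S G ≡ 1
          counted = cong₂ (λ a b → ι a * ι b) (≤ᵇ-intro large) (≤ᵇ-intro complete)

      copy-found : Σ (Fin t → Fin N) λ ψ → IsInducedCopy F (toHypergraph G⊆ws) ψ × Monochromatic F χ ψ
      copy-found = point x ∘ φ , ((inj , All.tabulate in-G) , induced) , c , All.tabulate coloured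

    -- `light` bounds the number of rounds starting from full containers; `sparse` makes missing
    -- `M ^ k / 2` given k-sets have probability at most `2 ^ -v`; `few` leaves at most `2 ^ v / 4`
    -- leaves; `rare` keeps the expected number of non-induced patterns below `∣X∣ / (4 * β ℓ)` or
    -- equal to it.
    module _
      (light   : γ * (q * N ^ k) < M ^ k * suc T)
      (sparse  : 2 * P * v ≤ M ^ k)
      (few     : 4 * suc (N ^ k) ^ depth (suc T) ≤ 2 ^ v)
      (rare    : 4 * (R ^ t * t ^ k * β ℓ) ≤ P ^ suc ℓ) where

      tree : Tree (depth (suc T)) (const ⊤)
      tree = build T (λ _ _ → true) (λ _ _ _ _ _ → refl) (≤-<-trans (*-monoʳ-≤ γ full-mass) light)
        where
        open ≤-Reasoning
        full-mass : mass (λ _ _ → true) ≤ q * N ^ k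
        full-mass = begin
          ∑ (allFin q) (λ _ → ∑ ws (λ _ → 1))   ≡⟨ trans (∑-const (allFin q) _) (cong₂ _*_ (length-tabulate {n = q} id) (trans (∑-const ws 1) (*-identityʳ _))) ⟩
          q * length ws                         ≤⟨ *-monoʳ-≤ q (length-kSubsets N k) ⟩
          q * N ^ k                             ∎

      𝔼-avoids : ∀ (U : Subset N → Bool) → M ^ k ≤ 2 * ∑ ws (ι ∘ U) → 𝔼 ws (λ G → ι (all (not ∘ U) G)) * 2 ^ v ≤ P ^ ∣W∣
      𝔼-avoids U large = *-cancelʳ-≤ (e * 2 ^ v) (P ^ ∣W∣) (P ^ u) {{m^n≢0 P u}} (begin
        e * 2 ^ v * P ^ u             ≡⟨ swap e (2 ^ v) (P ^ u) ⟩
        e * P ^ u * 2 ^ v             ≡⟨ cong (_* 2 ^ v) (𝔼-avoid ws U) ⟩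
        p ^ u * P ^ ∣W∣ * 2 ^ v       ≡⟨ swap (p ^ u) (P ^ ∣W∣) (2 ^ v) ⟩
        p ^ u * 2 ^ v * P ^ ∣W∣       ≤⟨ *-monoˡ-≤ (P ^ ∣W∣) (p^u*2^v≤P^u p v u Pv≤u) ⟩
        P ^ u * P ^ ∣W∣               ≡⟨ *-comm (P ^ u) (P ^ ∣W∣) ⟩
        P ^ ∣W∣ * P ^ u               ∎)
        where
        open ≤-Reasoning
        u = ∑ ws (ι ∘ U)
        e = 𝔼 ws (λ G → ι (all (not ∘ U) G))
        Pv≤u : P * v ≤ u
        Pv≤u = *-cancelˡ-≤ 2 (≤-trans (≤-reflexive (sym (*-assoc 2 P v))) (≤-trans sparse large))
        swap : ∀ a b c → a * b * c ≡ a * c * b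
        swap = solve-∀

      4𝔼-bad : 4 * 𝔼 ws (bad tree) ≤ P ^ ∣W∣
      4𝔼-bad = *-cancelʳ-≤ (4 * 𝔼 ws (bad tree)) (P ^ ∣W∣) (2 ^ v) {{m^n≢0 2 v}} (begin
        4 * 𝔼 ws (bad tree) * 2 ^ v                         ≡⟨ *-assoc 4 (𝔼 ws (bad tree)) (2 ^ v) ⟩
        4 * (𝔼 ws (bad tree) * 2 ^ v)                       ≤⟨ *-monoʳ-≤ 4 (𝔼-bad p v 𝔼-avoids tree) ⟩
        4 * (suc (N ^ k) ^ depth (suc T) * P ^ ∣W∣)         ≡⟨ *-assoc 4 (suc (N ^ k) ^ depth (suc T)) (P ^ ∣W∣) ⟨
        4 * suc (N ^ k) ^ depth (suc T) * P ^ ∣W∣           ≤⟨ *-monoˡ-≤ (P ^ ∣W∣) few ⟩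
        2 ^ v * P ^ ∣W∣                                     ≡⟨ *-comm (2 ^ v) (P ^ ∣W∣) ⟩
        P ^ ∣W∣ * 2 ^ v                                     ∎)
        where open ≤-Reasoning

      4𝔼-noninduced : 4 * (𝔼 ws total-noninduced * β ℓ) ≤ ∣X∣ * P ^ ∣W∣
      4𝔼-noninduced = *-cancelʳ-≤ (4 * (e * β ℓ)) (∣X∣ * P ^ ∣W∣) (P ^ suc ℓ) {{m^n≢0 P (suc ℓ)}} (begin
        4 * (e * β ℓ) * P ^ suc ℓ                             ≡⟨ rearrange₁ e (β ℓ) (P ^ suc ℓ) ⟩
        4 * β ℓ * (e * P ^ suc ℓ)                             ≤⟨ *-monoʳ-≤ (4 * β ℓ) 𝔼-total-noninduced ⟩
        4 * β ℓ * (∣X∣ * (R ^ t * t ^ k) * P ^ ∣W∣)           ≡⟨ rearrange₂ (β ℓ) ∣X∣ (R ^ t * t ^ k) (P ^ ∣W∣) ⟩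
        ∣X∣ * P ^ ∣W∣ * (4 * (R ^ t * t ^ k * β ℓ))           ≤⟨ *-monoʳ-≤ (∣X∣ * P ^ ∣W∣) rare ⟩
        ∣X∣ * P ^ ∣W∣ * P ^ suc ℓ                             ∎)
        where
        open ≤-Reasoning
        e = 𝔼 ws total-noninduced
        rearrange₁ : ∀ a b c → 4 * (a * b) * c ≡ 4 * b * (a * c)
        rearrange₁ = solve-∀
        rearrange₂ : ∀ b x y z → 4 * b * (x * y * z) ≡ x * z * (4 * (y * b))
        rearrange₂ = solve-∀

      ∣X∣≥1 : 1 ≤ ∣X∣
      ∣X∣≥1 = Setting.∣X∣≥1 setting

      -- Weighting `bad` by `∣X∣` joins both requirements in one expectation: each term has mean at
      -- most `∣X∣ / 4`, and a total below `∣X∣` forces `bad` to vanish.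
      good-sublist : Σ (List (Subset N)) λ G → G ⊆ ws × total-noninduced G * β ℓ + bad tree G * ∣X∣ < ∣X∣
      good-sublist = 𝔼-find ws _ ∣X∣ (≤-<-trans (≤-reflexive expand) (*-cancelˡ-< 4 _ _ (begin-strict
        4 * (e₁ * β ℓ + e₂ * ∣X∣)                  ≡⟨ rearrange (e₁ * β ℓ) e₂ ∣X∣ ⟩
        4 * (e₁ * β ℓ) + ∣X∣ * (4 * e₂)            ≤⟨ +-mono-≤ 4𝔼-noninduced (*-monoʳ-≤ ∣X∣ 4𝔼-bad) ⟩
        ∣X∣ * P ^ ∣W∣ + ∣X∣ * P ^ ∣W∣              <⟨ m<n+m _ (*-mono-≤ {1} {2} (s≤s z≤n) (*-mono-≤ ∣X∣≥1 (m^n>0 P ∣W∣))) ⟩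
        2 * (∣X∣ * P ^ ∣W∣) + (∣X∣ * P ^ ∣W∣ + ∣X∣ * P ^ ∣W∣) ≡⟨ rearrange′ ∣X∣ (P ^ ∣W∣) ⟩
        4 * (P ^ ∣W∣ * ∣X∣)                        ∎)))
        where
        open ≤-Reasoning
        e₁ = 𝔼 ws total-noninduced
        e₂ = 𝔼 ws (bad tree)
        expand : 𝔼 ws (λ G → total-noninduced G * β ℓ + bad tree G * ∣X∣) ≡ e₁ * β ℓ + e₂ * ∣X∣
        expand = trans (𝔼-+ ws _ _) (cong₂ _+_ (𝔼-*ʳ ws _ (β ℓ)) (𝔼-*ʳ ws _ ∣X∣))
        rearrange : ∀ a b x → 4 * (a + b * x) ≡ 4 * a + x * (4 * b)
        rearrange = solve-∀
        rearrange′ : ∀ x z → 2 * (x * z) + (x * z + x * z) ≡ 4 * (z * x)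
        rearrange′ = solve-∀

      bad≡0 : ∀ a b x → a + b * x < x → b ≡ 0
      bad≡0 a zero    x h = refl
      bad≡0 a (suc b) x h = ⊥-elim (<⇒≱ h (≤-trans (m≤m+n x (b * x)) (m≤n+m _ a)))

      sublist-arrows : (Σ (List (Subset N)) λ G → G ⊆ ws × total-noninduced G * β ℓ + bad tree G * ∣X∣ < ∣X∣) →
                       Σ (Hypergraph k N) λ G → InducedArrows G F q
      sublist-arrows (G , G⊆ws , small) = toHypergraph G⊆ws , λ χ →
        let f , c , h , big , known = walk G χ (Sublist.lookup G⊆ws) tree _ (bad≡0 _ (bad tree G) ∣X∣ small)
        in Found.copy-found G G⊆ws (≤-<-trans (m≤m+n _ _) small) χ f c h big known

      induced-arrows : Σ (Hypergraph k N) λ G → InducedArrows G F q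
      induced-arrows = sublist-arrows good-sublist

-- Choice of the parameters

n≤2^n : ∀ n → n ≤ 2 ^ n
n≤2^n zero    = z≤n
n≤2^n (suc n) = ≤-trans (+-mono-≤ (m^n>0 2 n) (n≤2^n n)) (≤-reflexive (cong (2 ^ n +_) (sym (+-identityʳ (2 ^ n)))))

module Parameters (k q t ℓ R b : ℕ) (k≥1 : 1 ≤ k) (q≥1 : 1 ≤ q) (ℓ≥1 : 1 ≤ ℓ) (R≥1 : 1 ≤ R)
  (q≤Q : q ≤ 2 ^ b) (t≤Q : t ≤ 2 ^ b) (ℓ≤Q : ℓ ≤ 2 ^ b) (k≤Q : k ≤ 2 ^ b) (2≤Q : 2 ≤ 2 ^ b) where

  Q u : ℕ
  Q = 2 ^ b
  u = k * (ℓ * ℓ)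

  instance
    nz-Q : NonZero Q
    nz-Q = m^n≢0 2 b
    nz-R : NonZero R
    nz-R = >-nonZero R≥1
    nz-ℓ : NonZero ℓ
    nz-ℓ = >-nonZero ℓ≥1
    nz-k : NonZero k
    nz-k = >-nonZero k≥1

  ℓℓ≤u : ℓ * ℓ ≤ u
  ℓℓ≤u = m≤n*m (ℓ * ℓ) k

  ℓ≤u : ℓ ≤ u
  ℓ≤u = ≤-trans (m≤m*n ℓ ℓ) ℓℓ≤u

  k≤u : k ≤ u
  k≤u = m≤m*n k (ℓ * ℓ) {{m*n≢0 ℓ ℓ}}

  1≤u : 1 ≤ u
  1≤u = ≤-trans k≥1 k≤u

  -- Every quantity is compared with a monomial in `Q` and `R`, so that estimates become additions
  -- of exponents.
  record Bounded (m a c : ℕ) : Set where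
    constructor bounded
    field bound : m ≤ Q ^ a * R ^ c
  open Bounded

  weaken-bound : ∀ {m a a′ c c′} → a ≤ a′ → c ≤ c′ → Bounded m a c → Bounded m a′ c′
  weaken-bound a≤ c≤ (bounded h) = bounded (≤-trans h (*-mono-≤ (^-monoʳ-≤ Q a≤) (^-monoʳ-≤ R c≤)))

  below : ∀ {m m′ a c} → m ≤ m′ → Bounded m′ a c → Bounded m a c
  below m≤ (bounded h) = bounded (≤-trans m≤ h)

  infixl 7 _⊗_
  _⊗_ : ∀ {m m′ a a′ c c′} → Bounded m a c → Bounded m′ a′ c′ → Bounded (m * m′) (a + a′) (c + c′)
  _⊗_ {m} {m′} {a} {a′} {c} {c′} (bounded h) (bounded h′) = bounded (begin
    m * m′                                     ≤⟨ *-mono-≤ h h′ ⟩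
    (Q ^ a * R ^ c) * (Q ^ a′ * R ^ c′)        ≡⟨ inter (Q ^ a) (R ^ c) (Q ^ a′) (R ^ c′) ⟩
    (Q ^ a * Q ^ a′) * (R ^ c * R ^ c′)        ≡⟨ cong₂ _*_ (^-distribˡ-+-* Q a a′) (^-distribˡ-+-* R c c′) ⟨
    Q ^ (a + a′) * R ^ (c + c′)                ∎)
    where
    open ≤-Reasoning
    inter : ∀ a b c d → (a * b) * (c * d) ≡ (a * c) * (b * d)
    inter = solve-∀

  bound-^ : ∀ {m a c} o → Bounded m a c → Bounded (m ^ o) (a * o) (c * o)
  bound-^ {m} {a} {c} o (bounded h) = bounded (begin
    m ^ o                            ≤⟨ ^-monoˡ-≤ o h ⟩
    (Q ^ a * R ^ c) ^ o              ≡⟨ ^-distribʳ-* o (Q ^ a) (R ^ c) ⟩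
    (Q ^ a) ^ o * (R ^ c) ^ o        ≡⟨ cong₂ _*_ (^-*-assoc Q a o) (^-*-assoc R c o) ⟩
    Q ^ (a * o) * R ^ (c * o)        ∎)
    where open ≤-Reasoning

  monomial : ∀ a c → Bounded (Q ^ a * R ^ c) a c
  monomial a c = bounded ≤-refl

  boundQ : ∀ {m} a → m ≤ Q ^ a → Bounded m a 0
  boundQ a h = bounded (≤-trans h (≤-reflexive (sym (*-identityʳ (Q ^ a)))))

  boundQ₁ : ∀ {m} → m ≤ Q → Bounded m 1 0
  boundQ₁ h = boundQ 1 (≤-trans h (≤-reflexive (sym (*-identityʳ Q))))

  bound2^ : ∀ a → Bounded (2 ^ a) a 0
  bound2^ a = boundQ a (^-monoˡ-≤ a 2≤Q)

  boundR : ∀ c → Bounded (R ^ c) 0 c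
  boundR c = bounded (≤-reflexive (sym (*-identityˡ (R ^ c))))

  -- The size of P is forced by rare and that of Y by sparse; M = r ^ (ℓ + 1) is a power of r, so that
  -- r divides (R * M) ^ k.
  z γ T Y P s r M : ℕ
  z = 6 * ℓ
  γ = 16 * q * z ^ ℓ
  T = γ * (q * R ^ k)
  Y = Q ^ (32 * ℓ) * R ^ (3 * k)
  P = Q ^ (41 * u) * R ^ (t + 3 * (k * ℓ))
  s = P * Y
  r = z * s
  M = r ^ suc ℓ

  P≥1 : 1 ≤ P
  P≥1 = *-mono-≤ (m^n>0 Q (41 * u)) (m^n>0 R (t + 3 * (k * ℓ)))

  Y≥1 : 1 ≤ Y
  Y≥1 = *-mono-≤ (m^n>0 Q (32 * ℓ)) (m^n>0 R (3 * k))

  s≥1 : 1 ≤ s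
  s≥1 = *-mono-≤ P≥1 Y≥1

  s≤r : s ≤ r
  s≤r = m≤n*m s z {{m*n≢0 6 ℓ}}

  r≥1 : 1 ≤ r
  r≥1 = ≤-trans s≥1 s≤r

  instance
    nz-r : NonZero r
    nz-r = >-nonZero r≥1

  M≥1 : 1 ≤ M
  M≥1 = m^n>0 r (suc ℓ)

  s^ℓ≤M : s ^ ℓ ≤ M
  s^ℓ≤M = ≤-trans (^-monoˡ-≤ ℓ s≤r) (^-monoʳ-≤ r (n≤1+n ℓ))

  -- The quotient of `4 * (R * M) ^ k` by `r`: in one of the factors `M = r ^ suc ℓ` a single `r` is
  -- struck out.
  J : ℕ
  J = 4 * R ^ k * (M ^ pred k * r ^ ℓ)

  Jr≡4n : J * r ≡ 4 * (R * M) ^ k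
  Jr≡4n = begin
    4 * R ^ k * (M ^ pred k * r ^ ℓ) * r       ≡⟨ rearrange (R ^ k) (M ^ pred k) (r ^ ℓ) r ⟩
    4 * (R ^ k * M ^ suc (pred k))             ≡⟨ cong (λ i → 4 * (R ^ k * M ^ i)) (suc-pred k) ⟩
    4 * (R ^ k * M ^ k)                        ≡⟨ cong (4 *_) (^-distribʳ-* k R M) ⟨
    4 * (R * M) ^ k                            ∎
    where
    open Relation.Binary.PropositionalEquality.≡-Reasoning
    rearrange : ∀ a b c r → 4 * a * (b * c) * r ≡ 4 * (a * ((r * c) * b))
    rearrange = solve-∀

  light : γ * (q * (R * M) ^ k) < M ^ k * suc T
  light = begin-strict
    γ * (q * (R * M) ^ k)         ≡⟨ cong (λ n → γ * (q * n)) (^-distribʳ-* k R M) ⟩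
    γ * (q * (R ^ k * M ^ k))     ≡⟨ rearrange γ q (R ^ k) (M ^ k) ⟩
    M ^ k * T                     <⟨ *-monoʳ-< (M ^ k) {{m^n≢0 M k {{>-nonZero M≥1}}}} ≤-refl ⟩
    M ^ k * suc T                 ∎
    where
    open ≤-Reasoning
    rearrange : ∀ g q a m → g * (q * (a * m)) ≡ m * (g * (q * a))
    rearrange = solve-∀

  z-bound : Bounded z 4 0
  z-bound = below (*-monoˡ-≤ ℓ (m≤m+n 6 2)) (bound2^ 3 ⊗ boundQ₁ ℓ≤Q)

  γ-bound : Bounded γ (9 * ℓ) 0
  γ-bound = weaken-bound (≤-trans (+-monoˡ-≤ (4 * ℓ) (*-monoʳ-≤ 5 ℓ≥1)) (≤-reflexive (sym (*-distribʳ-+ ℓ 5 4)))) ≤-refl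
              (bound2^ 4 ⊗ boundQ₁ q≤Q ⊗ bound-^ ℓ z-bound)

  T≥1 : 1 ≤ T
  T≥1 = *-mono-≤ (*-mono-≤ (*-mono-≤ {1} {16} (s≤s z≤n) q≥1) (m^n>0 z {{m*n≢0 6 ℓ}} ℓ)) (*-mono-≤ q≥1 (m^n>0 R k))

  sT-bound : Bounded (suc T) (11 * ℓ) k
  sT-bound = weaken-bound (exponent ℓ≥1) ≤-refl
    (below (+-mono-≤ T≥1 (≤-reflexive (sym (+-identityʳ T)))) (bound2^ 1 ⊗ (γ-bound ⊗ (boundQ₁ q≤Q ⊗ boundR k))))
    where
    exponent : 1 ≤ ℓ → 1 + (9 * ℓ + (1 + 0)) ≤ 11 * ℓ
    exponent h = ≤-trans (≤-reflexive (rearrange₁ ℓ)) (≤-trans (+-monoˡ-≤ (9 * ℓ) (*-monoʳ-≤ 2 h)) (≤-reflexive (rearrange₂ ℓ)))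
      where
      rearrange₁ : ∀ l → 1 + (9 * l + (1 + 0)) ≡ 2 * 1 + 9 * l
      rearrange₁ = solve-∀
      rearrange₂ : ∀ l → 2 * l + 9 * l ≡ 11 * l
      rearrange₂ = solve-∀

  r-bound : Bounded r (77 * u) (t + 6 * (k * ℓ))
  r-bound = weaken-bound Q-exponent R-exponent (z-bound ⊗ (monomial (41 * u) (t + 3 * (k * ℓ)) ⊗ monomial (32 * ℓ) (3 * k)))
    where
    open ≤-Reasoning
    Q-exponent : 4 + (41 * u + 32 * ℓ) ≤ 77 * u
    Q-exponent = begin
      4 + (41 * u + 32 * ℓ)        ≤⟨ +-mono-≤ (*-monoʳ-≤ 4 1≤u) (+-monoʳ-≤ (41 * u) (*-monoʳ-≤ 32 ℓ≤u)) ⟩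
      4 * u + (41 * u + 32 * u)    ≡⟨ rearrange u ⟩
      77 * u                       ∎
      where
      rearrange : ∀ u → 4 * u + (41 * u + 32 * u) ≡ 77 * u
      rearrange = solve-∀
    R-exponent : 0 + (t + 3 * (k * ℓ) + 3 * k) ≤ t + 6 * (k * ℓ)
    R-exponent = begin
      t + 3 * (k * ℓ) + 3 * k          ≤⟨ +-monoʳ-≤ (t + 3 * (k * ℓ)) (*-monoʳ-≤ 3 (m≤m*n k ℓ)) ⟩
      t + 3 * (k * ℓ) + 3 * (k * ℓ)    ≡⟨ rearrange t (k * ℓ) ⟩
      t + 6 * (k * ℓ)                  ∎
      where
      rearrange : ∀ t m → t + 3 * m + 3 * m ≡ t + 6 * m
      rearrange = solve-∀

  -- The constants of the theorem arise here. With `suc ℓ ≤ 2 * ℓ`, the exponent `77 * u` doubles to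
  -- 154, and that of `R` becomes `2 * t * ℓ + 12 * u`, with one more `u` to absorb the factor `R`
  -- of the grid.
  N-bound : Bounded (R * M) (154 * (u * ℓ)) (2 * (t * ℓ) + 13 * u)
  N-bound = weaken-bound (≤-reflexive (Q-exponent u ℓ)) R-exponent
    (below (≤-reflexive (sym (cong (_* M) (*-identityʳ R))))
      (boundR 1 ⊗ below (^-monoʳ-≤ r suc≤) (bound-^ (2 * ℓ) r-bound)))
    where
    open ≤-Reasoning
    suc≤ : suc ℓ ≤ 2 * ℓ
    suc≤ = +-mono-≤ ℓ≥1 (≤-reflexive (sym (+-identityʳ ℓ)))
    Q-exponent : ∀ u l → 0 + 77 * u * (2 * l) ≡ 154 * (u * l)
    Q-exponent = solve-∀
    R-exponent : 1 + (t + 6 * (k * ℓ)) * (2 * ℓ) ≤ 2 * (t * ℓ) + 13 * u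
    R-exponent = begin
      1 + (t + 6 * (k * ℓ)) * (2 * ℓ)  ≤⟨ +-monoˡ-≤ _ 1≤u ⟩
      u + (t + 6 * (k * ℓ)) * (2 * ℓ)  ≡⟨ rearrange t k ℓ ⟩
      2 * (t * ℓ) + 13 * u             ∎
      where
      rearrange : ∀ t k l → k * (l * l) + (t + 6 * (k * l)) * (2 * l) ≡ 2 * (t * l) + 13 * (k * (l * l))
      rearrange = solve-∀

  -- Λ bounds log₂ (1 + (R * M) ^ k) and is computed from N-bound rather than from M itself, since
  -- Y has to exceed it.
  E Λ : ℕ
  E = b * (154 * (u * ℓ)) + R * (2 * (t * ℓ) + 13 * u)
  Λ = suc (E * k)

  n<2^Λ : suc ((R * M) ^ k) ≤ 2 ^ Λ
  n<2^Λ = begin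
    suc ((R * M) ^ k)                 ≤⟨ +-monoˡ-≤ _ (m^n>0 (R * M) {{m*n≢0 R M {{nz-R}} {{>-nonZero M≥1}}}} k) ⟩
    (R * M) ^ k + (R * M) ^ k         ≡⟨ cong ((R * M) ^ k +_) (+-identityʳ _) ⟨
    2 * (R * M) ^ k                   ≤⟨ *-monoʳ-≤ 2 (^-monoˡ-≤ k N≤2^E) ⟩
    2 * (2 ^ E) ^ k                   ≡⟨ cong (2 *_) (^-*-assoc 2 E k) ⟩
    2 ^ Λ                             ∎
    where
    open ≤-Reasoning
    N≤2^E : R * M ≤ 2 ^ E
    N≤2^E = begin
      R * M
        ≤⟨ bound N-bound ⟩
      Q ^ (154 * (u * ℓ)) * R ^ (2 * (t * ℓ) + 13 * u)
        -- The crude `R ≤ 2 ^ R` suffices: it costs `Λ` only one factor `R`.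
        ≤⟨ *-monoʳ-≤ (Q ^ (154 * (u * ℓ))) (^-monoˡ-≤ (2 * (t * ℓ) + 13 * u) (n≤2^n R)) ⟩
      Q ^ (154 * (u * ℓ)) * (2 ^ R) ^ (2 * (t * ℓ) + 13 * u)
        ≡⟨ cong₂ _*_ (^-*-assoc 2 b _) (^-*-assoc 2 R _) ⟩
      2 ^ (b * (154 * (u * ℓ))) * 2 ^ (R * (2 * (t * ℓ) + 13 * u))
        ≡⟨ ^-distribˡ-+-* 2 (b * (154 * (u * ℓ))) _ ⟨
      2 ^ E ∎

  Λ-bound : Bounded Λ 14 1
  Λ-bound = below Λ≤ (bound2^ 8 ⊗ boundQ 6 ≤-refl ⊗ boundR 1)
    where
    open ≤-Reasoning
    Q⁴≤Q⁶ : Q ^ 4 ≤ Q ^ 6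
    Q⁴≤Q⁶ = ^-monoʳ-≤ Q (m≤m+n 4 2)
    Q³≤Q⁶ : Q ^ 3 ≤ Q ^ 6
    Q³≤Q⁶ = ^-monoʳ-≤ Q (m≤m+n 3 3)
    unfold : ∀ b k l t R → suc ((b * (154 * (k * (l * l) * l)) + R * (2 * (t * l) + 13 * (k * (l * l)))) * k) ≡
             1 + 154 * (b * (k * (k * (l * (l * (l * 1)))))) + R * (2 * (t * (l * (k * 1))) + 13 * (k * (l * (l * (k * 1)))))
    unfold = solve-∀
    refold : ∀ x R → R * x + 154 * (R * x) + R * (2 * x + 13 * x) ≡ 170 * x * (R * 1)
    refold = solve-∀
    -- Each product of `b`, `k`, `ℓ` and `t` has at most six factors, each at most `Q`. The
    -- coefficients `1 + 154 + 2 + 13` add up to 170, rounded up to `2 ^ 8`.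
    Λ≤ : Λ ≤ 256 * Q ^ 6 * R ^ 1
    Λ≤ = begin
      Λ
        ≡⟨ unfold b k ℓ t R ⟩
      1 + 154 * (b * (k * (k * (ℓ * (ℓ * (ℓ * 1)))))) + R * (2 * (t * (ℓ * (k * 1))) + 13 * (k * (ℓ * (ℓ * (k * 1)))))
        ≤⟨ +-mono-≤ (+-mono-≤ (*-mono-≤ R≥1 (m^n>0 Q 6)) (*-monoʳ-≤ 154 (≤-trans
             (*-mono-≤ (n≤2^n b) (*-mono-≤ k≤Q (*-mono-≤ k≤Q (*-mono-≤ ℓ≤Q (*-mono-≤ ℓ≤Q (*-monoˡ-≤ 1 ℓ≤Q))))))
             (m≤n*m (Q ^ 6) R))))
           (*-monoʳ-≤ R (+-mono-≤
             (*-monoʳ-≤ 2 (≤-trans (*-mono-≤ t≤Q (*-mono-≤ ℓ≤Q (*-monoˡ-≤ 1 k≤Q))) Q³≤Q⁶))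
             (*-monoʳ-≤ 13 (≤-trans (*-mono-≤ k≤Q (*-mono-≤ ℓ≤Q (*-mono-≤ ℓ≤Q (*-monoˡ-≤ 1 k≤Q)))) Q⁴≤Q⁶)))) ⟩
      R * Q ^ 6 + 154 * (R * Q ^ 6) + R * (2 * Q ^ 6 + 13 * Q ^ 6)
        ≡⟨ refold (Q ^ 6) R ⟩
      170 * Q ^ 6 * R ^ 1
        ≤⟨ *-monoˡ-≤ (R ^ 1) (*-monoˡ-≤ (Q ^ 6) (m≤m+n 170 86)) ⟩
      256 * Q ^ 6 * R ^ 1 ∎

  L v : ℕ
  L = suc T * suc (ℓ * J)
  v = 2 + Λ * L

  few : 4 * suc ((R * M) ^ k) ^ L ≤ 2 ^ v
  few = begin
    4 * suc ((R * M) ^ k) ^ L    ≤⟨ *-monoʳ-≤ 4 (^-monoˡ-≤ L n<2^Λ) ⟩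
    4 * (2 ^ Λ) ^ L              ≡⟨ cong (4 *_) (^-*-assoc 2 Λ L) ⟩
    4 * 2 ^ (Λ * L)              ≡⟨ ^-distribˡ-+-* 2 2 (Λ * L) ⟨
    2 ^ v                        ∎
    where open ≤-Reasoning

  J≥1 : 1 ≤ J
  J≥1 = *-mono-≤ (*-mono-≤ {1} {4} (s≤s z≤n) (m^n>0 R k)) (*-mono-≤ (m^n>0 M {{>-nonZero M≥1}} (pred k)) (m^n>0 r ℓ))

  -- The exponents of `Y` are chosen for this estimate: `21 + 11 * ℓ ≤ 32 * ℓ` for `Q` and
  -- `2 * k + 1 ≤ 3 * k` for `R`.
  cost≤Y : 48 * ℓ * suc T * R ^ k * Λ ≤ Y
  cost≤Y = bound (weaken-bound Q-exponent R-exponent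
    (below (*-monoˡ-≤ Λ (*-monoˡ-≤ (R ^ k) (*-monoˡ-≤ (suc T) (*-monoˡ-≤ ℓ (m≤m+n 48 16)))))
             (bound2^ 6 ⊗ boundQ₁ ℓ≤Q ⊗ sT-bound ⊗ boundR k ⊗ Λ-bound)))
    where
    open ≤-Reasoning
    Q-exponent : 6 + 1 + 11 * ℓ + 0 + 14 ≤ 32 * ℓ
    Q-exponent = begin
      6 + 1 + 11 * ℓ + 0 + 14   ≡⟨ rearrange₁ ℓ ⟩
      21 * 1 + 11 * ℓ           ≤⟨ +-monoˡ-≤ (11 * ℓ) (*-monoʳ-≤ 21 ℓ≥1) ⟩
      21 * ℓ + 11 * ℓ           ≡⟨ *-distribʳ-+ ℓ 21 11 ⟨
      32 * ℓ                    ∎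
      where
      rearrange₁ : ∀ l → 6 + 1 + 11 * l + 0 + 14 ≡ 21 * 1 + 11 * l
      rearrange₁ = solve-∀
    R-exponent : 0 + 0 + k + k + 1 ≤ 3 * k
    R-exponent = ≤-trans (+-monoʳ-≤ (k + k) k≥1) (≤-reflexive (rearrange k))
      where
      rearrange : ∀ k → k + k + k ≡ 3 * k
      rearrange = solve-∀

  -- Multiplication by `r` turns the factor `J` of `v` into `4 * (R * M) ^ k`. Once `M ^ k` is split
  -- off, what remains is `P` times the cost, at most `P * Y = s ≤ r`.
  sparse : 2 * P * v ≤ M ^ k
  sparse = *-cancelʳ-≤ (2 * P * v) (M ^ k) r (begin
    2 * P * v * r
      ≤⟨ *-monoˡ-≤ r (*-monoʳ-≤ (2 * P) v≤) ⟩
    2 * P * (3 * (Λ * (suc T * (2 * (ℓ * J))))) * r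
      ≡⟨ rearrange₁ P Λ (suc T) ℓ J r ⟩
    12 * P * Λ * suc T * ℓ * (J * r)
      ≡⟨ cong (12 * P * Λ * suc T * ℓ *_) (trans Jr≡4n (cong (4 *_) (^-distribʳ-* k R M))) ⟩
    12 * P * Λ * suc T * ℓ * (4 * (R ^ k * M ^ k))
      ≡⟨ rearrange₂ P Λ (suc T) ℓ (R ^ k) (M ^ k) ⟩
    M ^ k * (P * (48 * ℓ * suc T * R ^ k * Λ))
      ≤⟨ *-monoʳ-≤ (M ^ k) (≤-trans (*-monoʳ-≤ P cost≤Y) s≤r) ⟩
    M ^ k * r ∎)
    where
    open ≤-Reasoning
    rearrange₁ : ∀ P Λ T l J r → 2 * P * (3 * (Λ * (T * (2 * (l * J))))) * r ≡ 12 * P * Λ * T * l * (J * r)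
    rearrange₁ = solve-∀
    rearrange₂ : ∀ P Λ T l a m → 12 * P * Λ * T * l * (4 * (a * m)) ≡ m * (P * (48 * l * T * a * Λ))
    rearrange₂ = solve-∀
    ΛL≥1 : 1 ≤ Λ * L
    ΛL≥1 = *-mono-≤ {1} {Λ} (s≤s z≤n) (*-mono-≤ {1} {suc T} (s≤s z≤n) (s≤s z≤n))
    v≤ : v ≤ 3 * (Λ * (suc T * (2 * (ℓ * J))))
    v≤ = begin
      2 + Λ * L                               ≤⟨ +-monoˡ-≤ (Λ * L) (*-monoʳ-≤ 2 ΛL≥1) ⟩
      2 * (Λ * L) + Λ * L                     ≡⟨ rearrange (Λ * L) ⟩
      3 * (Λ * L)                             ≤⟨ *-monoʳ-≤ 3 (*-monoʳ-≤ Λ (*-monoʳ-≤ (suc T) (+-mono-≤ (*-mono-≤ ℓ≥1 J≥1) (≤-reflexive (sym (+-identityʳ (ℓ * J))))))) ⟩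
      3 * (Λ * (suc T * (2 * (ℓ * J))))       ∎
      where
      rearrange : ∀ x → 2 * x + x ≡ 3 * x
      rearrange = solve-∀

  -- The factor `P ^ ℓ` inside `r ^ ℓ` cancels. The one factor `P` left over, due to the extra
  -- non-edge of a non-induced pattern, has to absorb everything else, which dictates its exponents.
  rare : 4 * (R ^ t * t ^ k * (2 * q * r ^ ℓ)) ≤ P ^ suc ℓ
  rare = begin
    4 * (R ^ t * t ^ k * (2 * q * r ^ ℓ))
      ≡⟨ cong (λ x → 4 * (R ^ t * t ^ k * (2 * q * x))) (trans (^-distribʳ-* ℓ z s) (cong (z ^ ℓ *_) (^-distribʳ-* ℓ P Y))) ⟩
    4 * (R ^ t * t ^ k * (2 * q * (z ^ ℓ * (P ^ ℓ * Y ^ ℓ))))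
      ≡⟨ rearrange (R ^ t) (t ^ k) q (z ^ ℓ) (P ^ ℓ) (Y ^ ℓ) ⟩
    8 * q * t ^ k * z ^ ℓ * Y ^ ℓ * R ^ t * P ^ ℓ
      ≤⟨ *-monoˡ-≤ (P ^ ℓ) (bound (weaken-bound Q-exponent (≤-reflexive (R-exponent k t ℓ))
           (bound2^ 3 ⊗ boundQ₁ q≤Q ⊗ bound-^ k (boundQ₁ t≤Q) ⊗ bound-^ ℓ z-bound ⊗ bound-^ ℓ (monomial (32 * ℓ) (3 * k)) ⊗ boundR t))) ⟩
    P * P ^ ℓ ∎
    where
    open ≤-Reasoning
    rearrange : ∀ a b q z p y → 4 * (a * b * (2 * q * (z * (p * y)))) ≡ 8 * q * b * z * y * a * p
    rearrange = solve-∀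
    Q-exponent : 3 + 1 + 1 * k + 4 * ℓ + 32 * ℓ * ℓ + 0 ≤ 41 * u
    Q-exponent = begin
      4 + 1 * k + 4 * ℓ + 32 * ℓ * ℓ + 0          ≡⟨ rearr₁ k ℓ ⟩
      4 * 1 + k + 4 * ℓ + 32 * (ℓ * ℓ)            ≤⟨ +-mono-≤ (+-mono-≤ (+-mono-≤ (*-monoʳ-≤ 4 1≤u) k≤u) (*-monoʳ-≤ 4 ℓ≤u)) (*-monoʳ-≤ 32 ℓℓ≤u) ⟩
      4 * u + u + 4 * u + 32 * u                  ≡⟨ rearr₂ u ⟩
      41 * u                                      ∎
      where
      rearr₁ : ∀ k l → 4 + 1 * k + 4 * l + 32 * l * l + 0 ≡ 4 * 1 + k + 4 * l + 32 * (l * l)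
      rearr₁ = solve-∀
      rearr₂ : ∀ u → 4 * u + u + 4 * u + 32 * u ≡ 41 * u
      rearr₂ = solve-∀
    R-exponent : ∀ k t l → 0 + 0 + 0 * k + 0 * l + 3 * k * l + t ≡ t + 3 * (k * l)
    R-exponent = solve-∀

  N-final : R * M ≤ 2 ^ (154 * k * ℓ ^ 3 * b) * R ^ (13 * k * ℓ ^ 2 + 2 * t * ℓ)
  N-final = ≤-trans (bound N-bound) (≤-reflexive (cong₂ _*_
    (trans (^-*-assoc 2 b (154 * (u * ℓ))) (cong (2 ^_) (exponent₁ b k ℓ)))
    (cong (R ^_) (exponent₂ t k ℓ))))
    where
    exponent₁ : ∀ b k l → b * (154 * (k * (l * l) * l)) ≡ 154 * k * (l * (l * (l * 1))) * b
    exponent₁ = solve-∀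
    exponent₂ : ∀ t k l → 2 * (t * l) + 13 * (k * (l * l)) ≡ 13 * k * (l * (l * 1)) + 2 * t * l
    exponent₂ = solve-∀

-- The logarithm and the final bound

n≤2^⌈log2⌉ : ∀ n (a : Acc _<_ n) → n ≤ 2 ^ ⌈log2⌉ n a
n≤2^⌈log2⌉ zero          _        = z≤n
n≤2^⌈log2⌉ (suc zero)    _        = ≤-refl
n≤2^⌈log2⌉ (suc (suc n)) (acc rs) = ≤-trans (halves n) (*-monoʳ-≤ 2 (n≤2^⌈log2⌉ (suc ⌈ n /2⌉) (rs _)))
  where
  halves : ∀ n → suc (suc n) ≤ 2 * suc ⌈ n /2⌉
  halves n = begin
    suc (suc n)                          ≡⟨ cong (2 +_) (⌊n/2⌋+⌈n/2⌉≡n n) ⟨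
    suc (suc (⌊ n /2⌋ + ⌈ n /2⌉))        ≤⟨ s≤s (s≤s (+-monoˡ-≤ ⌈ n /2⌉ (⌊n/2⌋≤⌈n/2⌉ n))) ⟩
    suc (suc (⌈ n /2⌉ + ⌈ n /2⌉))        ≡⟨ rearrange ⌈ n /2⌉ ⟩
    2 * suc ⌈ n /2⌉                      ∎
    where
    open ≤-Reasoning
    rearrange : ∀ m → suc (suc (m + m)) ≡ 2 * suc m
    rearrange = solve-∀

n≤2^⌈log₂n⌉ : ∀ n → n ≤ 2 ^ ⌈log₂ n ⌉
n≤2^⌈log₂n⌉ n = n≤2^⌈log2⌉ n (<-wellFounded n)

k≤t : ∀ {k t} (F : Hypergraph k t) → 1 ≤ numEdges F → k ≤ t
k≤t F ℓ≥1 = first (edges F) (uniform F) ℓ≥1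
  where
  first : ∀ {k t} (es : List (Subset t)) → All (λ e → ∣ e ∣ ≡ k) es → 1 ≤ length es → k ≤ t
  first (e ∷ _) (refl ∷ _) _ = ∣p∣≤n e

arrows⇒t≤R : ∀ {k t R q} (F : Hypergraph k t) → Fin q → CompleteArrows R F q → t ≤ R
arrows⇒t≤R F c arrows = Fin.injective⇒≤ (proj₁ (proj₂ (arrows (const c))))

induced-ramsey : ∀ (k q t : ℕ) → 1 ≤ k → 2 ≤ q → (F : Hypergraph k t) → 1 ≤ numEdges F →
                 ∀ R → CompleteArrows R F q →
                 Σ ℕ λ n → Σ (Hypergraph k n) λ G → InducedArrows G F q ×
                   n ≤ 2 ^ (154 * k * numEdges F ^ 3 * ⌈log₂ (q * t * numEdges F) ⌉)
                       * R ^ (13 * k * numEdges F ^ 2 + 2 * t * numEdges F)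
induced-ramsey k q t k≥1 q≥2 F ℓ≥1 R arrows = R * M , proj₁ result , proj₂ result , N-final
  where
  ℓ b : ℕ
  ℓ = numEdges F
  b = ⌈log₂ (q * t * ℓ) ⌉
  q≥1 : 1 ≤ q
  q≥1 = ≤-trans (s≤s z≤n) q≥2
  t≥1 : 1 ≤ t
  t≥1 = ≤-trans k≥1 (k≤t F ℓ≥1)
  c₀ : Fin q
  c₀ = Fin.fromℕ< q≥1
  instance
    q≢0 : NonZero q
    q≢0 = >-nonZero q≥1
    t≢0 : NonZero t
    t≢0 = >-nonZero t≥1
    ℓ≢0 : NonZero ℓ
    ℓ≢0 = >-nonZero ℓ≥1
  qtℓ≤Q : q * t * ℓ ≤ 2 ^ b
  qtℓ≤Q = n≤2^⌈log₂n⌉ (q * t * ℓ)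
  qt≤Q : q * t ≤ 2 ^ b
  qt≤Q = ≤-trans (m≤m*n (q * t) ℓ) qtℓ≤Q
  q≤Q : q ≤ 2 ^ b
  q≤Q = ≤-trans (m≤m*n q t) qt≤Q
  t≤Q : t ≤ 2 ^ b
  t≤Q = ≤-trans (m≤n*m t q) qt≤Q
  -- An existing edge gives `k ≤ t`, and a constant colouring gives `t ≤ R`; hence `R ≥ 1` and
  -- `k ≤ Q`. The bound `2 ≤ Q` comes from `q ≥ 2`.
  open Parameters k q t ℓ R b k≥1 q≥1 ℓ≥1 (≤-trans t≥1 (arrows⇒t≤R F c₀ arrows)) q≤Q t≤Q
    (≤-trans (m≤n*m ℓ (q * t) {{m*n≢0 q t}}) qtℓ≤Q) (≤-trans (k≤t F ℓ≥1) t≤Q) (≤-trans q≥2 q≤Q)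
  P≡ : P ≡ suc (pred P)
  P≡ = sym (suc-pred P {{>-nonZero P≥1}})
  result : Σ (Hypergraph k (R * M)) λ G → InducedArrows G F q
  result = Copies.Random-hypergraph.induced-arrows {k} {t} {q} {R} F M arrows c₀ s J T (pred P) v
    (≤-trans t≥1 (arrows⇒t≤R F c₀ arrows)) M≥1 ℓ≥1 s≥1 s^ℓ≤M (≤-reflexive (sym Jr≡4n)) light
    (subst (λ P → 2 * P * v ≤ M ^ k) P≡ sparse) few
    (subst (λ P → 4 * (R ^ t * t ^ k * (2 * q * r ^ ℓ)) ≤ P ^ suc ℓ) P≡ rare)

theorem1 : Σ ℕ λ c₁ → Σ ℕ λ c₂ → Σ ℕ λ c₃ → c₁ ≥ 1 × c₂ ≥ 1 × c₃ ≥ 1 ×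
    (∀ (k q t : ℕ) → k ≥ 1 → q ≥ 2 → (F : Hypergraph k t) → numEdges F ≥ 1 →
      ∀ (R : ℕ) → IsRamseyNumber F q R →
      Σ ℕ λ n → Σ (Hypergraph k n) λ G → InducedArrows G F q ×
        n ≤ 2 ^ (c₁ * k * numEdges F ^ 3 * ⌈log₂ (q * t * numEdges F) ⌉)
              * R ^ (c₂ * k * numEdges F ^ 2 + c₃ * t * numEdges F))
theorem1 = 154 , 13 , 2 , s≤s z≤n , s≤s z≤n , s≤s z≤n ,
  λ k q t k≥1 q≥2 F ℓ≥1 R (arrows , _) → induced-ramsey k q t k≥1 q≥2 F ℓ≥1 R arrows
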